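{- Let $k\ge 2$ and let $\mathcal{H}$ be a finite $k$-uniform hypergraph satisfying all of the following: (i) $\mathcal{H}$ has a vertex $z$ of degree $2$; (ii) $\delta(\mathcal{H} \setminus \{z\}) \geq 3$ and $d_{\mathcal H}(u) \geq 4$ for every $u \in V(\mathcal{H}) \setminus \{z\}$; (iii) $\mathcal{H} \setminus \{z\}$ has a fast winning strategy; (iv) for every two edges $e, e' \in E(\mathcal{H})$, every monomorphism $\phi : V(\mathcal{H} \setminus \{e, e'\}) \to V(\mathcal{H})$ is the identity; (v) $e \cap r \neq \emptyset$ and $e \cap g \neq \emptyset$ for every edge $e \in E(\mathcal{H})$, where $r$ and $g$ are the two edges of $\mathcal{H}$ incident with $z$; (vi) $|V(\mathcal{H}) \setminus (r \cup g)| < k-1$. Then the strong game $\mathcal{R}^{(k)}(\mathcal{H}, \aleph_0)$ is a draw.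
   Context: The strong game $\mathcal{R}^{(k)}(\mathcal{H}, \aleph_0)$: FP (first player) and SP (second player) alternately claim unclaimed edges of the countably infinite complete $k$-uniform hypergraph $K^k_{\mathbb{N}}$, one per move, FP first; the first player whose claimed edges contain a copy of $\mathcal{H}$ (a subhypergraph isomorphic to $\mathcal{H}$) wins; if neither player has a strategy ensuring his win in finitely many moves, the game is a draw. $d_{\mathcal H}(x)$ is the number of edges of $\mathcal H$ containing $x$, and $\delta$ is the minimum degree. $\mathcal{H}\setminus\{z\}$ for a vertex $z$ is the hypergraph obtained by deleting $z$ and all edges containing it. For a set $S$ of edges, $\mathcal{H}\setminus S$ is the hypergraph with edge set $E(\mathcal H)\setminus S$, and $V(\mathcal{H}\setminus S)$ denotes the union of its edges. A monomorphism $\phi: V(\mathcal{F}')\to V(\mathcal{F})$ (for $\mathcal F'\subseteq \mathcal F$) is an injective map such that $\phi(x)=\{\phi(a): a\in x\}$ is an edge of $\mathcal F$ for every edge $x$ of $\mathcal F'$; "$\phi$ is the identity" means $\phi(a)=a$ for all $a$ in its domain. A $k$-graph $\mathcal{F}$ has a fast winning strategy if, in the game where two players alternately claim unclaimed edges of $K^k_{\mathbb N}$, a player can ensure that his claimed edges contain a copy of $\mathcal{F}$ after $|E(\mathcal{F})|$ of his moves (disregarding whether the opponent builds a copy first). -}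

module Defs where

open import Data.Bool.Properties using () renaming (_≟_ to _≟ᵇ_)
open import Data.Fin using (Fin)
open import Data.Fin.Subset using (Subset; _∈_; _∉_; _⊆_; _-_; ∣_∣; ⋃)
open import Data.Fin.Subset.Properties
  using (_∈?_; x∈p∧x≢y⇒x∈p-y; p⊆p∪q; q⊆p∪q; ⊆-trans)
open import Data.List using (List; _∷_; length; filter; map; allFin; applyUpTo)
open import Data.List.Extrema.Nat using (min)
import Data.List.Membership.Propositional as List∈
import Data.List.Membership.DecPropositional as DecList∈
open import Data.List.Relation.Unary.All as All using (All)
import Data.List.Relation.Unary.All.Properties as Allₚ
open import Data.List.Relation.Unary.Any using (here; there)
open import Data.List.Relation.Unary.Unique.Propositional using (Unique)
import Data.List.Relation.Unary.Unique.Propositional.Properties as Uniqueₚ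
open import Data.Nat using (ℕ; suc; _*_; _<_)
open import Data.Product using (_×_; _,_; ∃)
open import Data.Vec using (Vec)
import Data.Vec.Membership.Propositional as Vec∈
open import Data.Vec.Properties using (≡-dec)
open import Data.Vec.Relation.Unary.Linked using (Linked)
open import Relation.Binary.Definitions using (DecidableEquality)
open import Relation.Binary.PropositionalEquality using (_≡_; refl)
open import Relation.Nullary using (¬_; ¬?)
open import Relation.Unary using (Pred; _≐_)
open import Level using (0ℓ)

------------------------------------------------------------------------
-- Finite k-uniform hypergraphs

-- The vertex set is a subset of an ambient Fin n, so that deleting vertices
-- or edges stays within the same type.
record Hypergraph (k n : ℕ) : Set where
  field
    V       : Subset n
    E       : List (Subset n)
    unique  : Unique E
    uniform : All (λ e → ∣ e ∣ ≡ k) E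
    E⊆V     : All (_⊆ V) E

open Hypergraph public

module _ {k n : ℕ} where

  degree : Hypergraph k n → Fin n → ℕ
  degree F x = length (filter (x ∈?_) (E F))

  -- The default value length (E F) bounds every degree from above, so it
  -- only matters when V F is empty.
  δ : Hypergraph k n → ℕ
  δ F = min (length (E F)) (map (degree F) (filter (_∈? V F) (allFin n)))

  infixl 5 _∖ᵛ_ _∖ᴱ_

  _∖ᵛ_ : Hypergraph k n → Fin n → Hypergraph k n
  F ∖ᵛ z = record
    { V       = V F - z
    ; E       = filter avoids? (E F)
    ; unique  = Uniqueₚ.filter⁺ avoids? (unique F)
    ; uniform = Allₚ.filter⁺ avoids? (uniform F)
    ; E⊆V     = All.map
        (λ (z∉e , e⊆V) {x} x∈e →
          x∈p∧x≢y⇒x∈p-y (e⊆V x∈e) (λ { refl → z∉e x∈e }))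
        (All.zip (Allₚ.all-filter avoids? (E F) , Allₚ.filter⁺ avoids? (E⊆V F)))
    }
    where
    avoids? = λ e → ¬? (z ∈? e)

  _≟ˢ_ : DecidableEquality (Subset n)
  _≟ˢ_ = ≡-dec _≟ᵇ_

  ⊆⋃ : ∀ {e : Subset n} (S : List (Subset n)) → e List∈.∈ S → e ⊆ ⋃ S
  ⊆⋃ (_ ∷ S) (here refl) = p⊆p∪q (⋃ S)
  ⊆⋃ (d ∷ S) (there e∈S) = ⊆-trans (⊆⋃ S e∈S) (q⊆p∪q d (⋃ S))

  -- Unlike in F ∖ᵛ z, vertices that become isolated are dropped.
  _∖ᴱ_ : Hypergraph k n → List (Subset n) → Hypergraph k n
  F ∖ᴱ S = record
    { V       = ⋃ remaining
    ; E       = remaining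
    ; unique  = Uniqueₚ.filter⁺ outside? (unique F)
    ; uniform = Allₚ.filter⁺ outside? (uniform F)
    ; E⊆V     = All.tabulate (λ {e} → ⊆⋃ {e} remaining)
    }
    where
    outside?  = λ e → ¬? (DecList∈._∈?_ _≟ˢ_ e S)
    remaining = filter outside? (E F)

Image : ∀ {n} {A : Set} → (Fin n → A) → Subset n → Pred A 0ℓ
Image φ x b = ∃ λ a → a ∈ x × φ a ≡ b

InjectiveOn : ∀ {n} {A : Set} → Subset n → (Fin n → A) → Set
InjectiveOn U φ = ∀ {a b} → a ∈ U → b ∈ U → φ a ≡ φ b → a ≡ b

-- A map V F′ → V F is given by a function on the ambient type, whose values
-- outside V F′ are irrelevant.
record Monomorphism {k n} (F′ F : Hypergraph k n) (φ : Fin n → Fin n) : Set where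
  field
    maps-V    : ∀ {a} → a ∈ V F′ → φ a ∈ V F
    injective : InjectiveOn (V F′) φ
    maps-E    : ∀ {x} → x List∈.∈ E F′ →
                ∃ λ y → y List∈.∈ E F × (_∈ y) ≐ Image φ x

------------------------------------------------------------------------
-- The board

-- Edges of the complete k-uniform hypergraph on ℕ: a k-subset of ℕ is
-- represented by its increasing enumeration, so _≡_ is equality of sets.
record Edge (k : ℕ) : Set where
  constructor edge
  field
    elements   : Vec ℕ k
    increasing : Linked _<_ elements

open Edge public

record Copy {k n} (F : Hypergraph k n) (C : Pred (Edge k) 0ℓ) : Set where
  field
    φ         : Fin n → ℕ
    injective : InjectiveOn (V F) φ
    maps-E    : ∀ {x} → x List∈.∈ E F →
                ∃ λ e → C e × (Vec∈._∈ elements e) ≐ Image φ x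

------------------------------------------------------------------------
-- Plays and strategies

data Player : Set where
  FP SP : Player

opponent : Player → Player
opponent FP = SP
opponent SP = FP

-- Moves are numbered from 0; turn P i is the number of P's move with index i.
turn : Player → ℕ → ℕ
turn FP i = 2 * i
turn SP i = suc (2 * i)

-- p t is the edge claimed at move t. Play is continued forever, also after
-- somebody has won.
Play : ℕ → Set
Play k = ℕ → Edge k

history : ∀ {k} → Play k → ℕ → List (Edge k)
history = applyUpTo

Legal : ∀ {k} → Play k → Set
Legal p = ∀ t → p t List∈.∉ history p t

-- The moves made so far, in chronological order, determine the next move. As
-- the board is infinite, there is no loss in having a strategy answer every
-- list of edges with an edge not on it.
record Strategy (k : ℕ) : Set where
  field
    move  : List (Edge k) → Edge k
    legal : ∀ h → move h List∈.∉ h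

open Strategy public

Follows : ∀ {k} → Player → Strategy k → Play k → Set
Follows P σ p = ∀ i → p (turn P i) ≡ move σ (history p (turn P i))

-- The edges that P has claimed before move t.
Claimed : ∀ {k} → Play k → Player → ℕ → Pred (Edge k) 0ℓ
Claimed p P t e = ∃ λ i → turn P i < t × p (turn P i) ≡ e

-- P is the first to own a copy of H. Claimed edges are never lost, so it is
-- enough that the opponent owns no copy at the moment t when P does.
Wins : ∀ {k n} → Hypergraph k n → Player → Play k → Set
Wins H P p = ∃ λ t → Copy H (Claimed p P t) × ¬ Copy H (Claimed p (opponent P) t)

WinningStrategy : ∀ {k n} → Hypergraph k n → Player → Strategy k → Set
WinningStrategy H P σ = ∀ p → Legal p → Follows P σ p → Wins H P p

Draw : ∀ {k n} → Hypergraph k n → Set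
Draw H = ∀ P → ¬ ∃ λ σ → WinningStrategy H P σ

-- At time turn P m the player P has made exactly m moves. The player may be
-- either of the two; since the board is infinite, it does not matter which.
FastWinningStrategy : ∀ {k n} → Hypergraph k n → Set
FastWinningStrategy {k} F =
  ∃ λ P → ∃ λ (σ : Strategy k) →
    ∀ p → Legal p → Follows P σ p → Copy F (Claimed p P (turn P (length (E F))))

{-# OPTIONS --safe #-}

-- Let F be H without z. The drawing player D first builds a copy χ of F with the fast strategy, on
-- vertices that avoid the opponent's first edge e₁. Then D makes threats at fresh vertices v: D
-- claims one of the edges χ(r), χ(g) with z placed at v, and the opponent has to answer with the
-- other one. As v has degree 1 or 2 in the opponent's graph, an answer can only be of use to him as
-- the image of r or g in a copy of H whose part ψ(F) he owned before the first threat.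
--
-- If the opponent makes no threat when χ(F) is complete, then any such ψ(F) avoids e₁ by (v), so it
-- consists of all the other edges he has; by (iv) this determines ψ, and for one of the two orders
-- of r and g no answer is of use.
--
-- If he does threaten to complete a copy φ of H, then D blocks. By (iv) every further threat arises
-- by moving z to a new vertex in φ(H), so that D knows the blocking edge, until he stops making
-- threats. All copies of F in his graph then lie in φ(V H), which contains e₁. By (vi) there is
-- no room in φ(V H) for χ((r ∪ g) - z) as well, so for one of the orders no answer is of use.
module Submission where

open import Defs
open import Data.Empty using (⊥; ⊥-elim)
open import Data.Fin using (Fin; zero; suc; toℕ; punchOut)
open import Data.Fin.Properties as Finₚ
  using (any?; all?; injective⇒≤; punchOut-injective; toℕ-injective)
  renaming (_≟_ to _≟ᶠ_)
open import Data.Fin.Subset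
  using (Subset; inside; outside; _∈_; _∉_; _⊆_; _∩_; _∪_; _─_; _-_; ∣_∣; ⋃; Nonempty)
  renaming (⊤ to full)
open import Data.Fin.Subset.Properties
  using (_∈?_; ⊆-antisym; x∈p∩q⁻; x∈p∪q⁻; x∈p∧x≢y⇒x∈p-y; x∈p∧x∉q⇒x∈p─q; p─q⊆p; x∈⁅x⁆; ∈⊤; ∉⊥; ∣⊤∣≡n)
open import Data.List using (List; []; _∷_; _++_; length; map; filter; lookup)
open import Data.List.Extrema.Nat using (f[argmin]≤v⁺)
open import Data.List.Membership.Propositional
  using (find; lose)
  renaming (_∈_ to _∈ᴸ_; _∉_ to _∉ᴸ_)
open import Data.List.Membership.Propositional.Properties
  using (∈-lookup; ∈-map⁺; ∈-map⁻; ∈-++⁺ˡ; ∈-++⁺ʳ; ∈-++⁻; ∈-filter⁺; ∈-filter⁻; ∈-allFin)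
import Data.List.Membership.DecPropositional as DecMembership
open import Data.List.Properties using (applyUpTo-∷ʳ; length-map; length-++; ++-assoc)
open import Data.List.Relation.Binary.Permutation.Propositional using (↭-sym; ↭⇒↭ₛ)
open import Data.List.Relation.Binary.Permutation.Propositional.Properties
  using (∈-resp-↭; ↭-length)
import Data.List.Relation.Binary.Permutation.Setoid.Properties as Permutation
open import Data.List.Relation.Unary.All as All using (All; []; _∷_)
import Data.List.Relation.Unary.All.Properties as Allₚ
open import Data.List.Relation.Unary.AllPairs using ([]; _∷_)
open import Data.List.Relation.Unary.Any as Any using (Any; here; there; index)
open import Data.List.Relation.Unary.Any.Properties using (lookup-index)
open import Data.List.Relation.Unary.Linked using (Linked; []; [-]; _∷_)
open import Data.List.Relation.Unary.Unique.Propositional using (Unique)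
import Data.List.Relation.Unary.Unique.Propositional.Properties as Uniqueₚ
open import Data.List.Sort using (sort-↭; sort-↗)
open import Data.Nat using (ℕ; zero; suc; _+_; _*_; _∸_; _≤_; _<_; z≤n; s≤s; _≤?_; _⊔_)
open import Data.Nat.Properties as ℕₚ
  using (≤-refl; ≤-trans; <-irrefl; <⇒≤; ≤∧≢⇒<; ≤-decTotalOrder; <-irrelevant)
  renaming (_≟_ to _≟ℕ_)
open import Data.Product using (Σ; ∃; _×_; _,_; proj₁; proj₂)
open import Data.Sum using (_⊎_; inj₁; inj₂; [_,_]′)
open import Data.Vec as Vec using (Vec; []; _∷_)
open import Data.Vec.Membership.Propositional
  using ()
  renaming (_∈_ to _∈ⱽ_; lose to loseⱽ; find to findⱽ)
open import Data.Vec.Membership.Propositional.Properties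
  using (∈-fromList⁺; ∈-fromList⁻; ∈-toList⁻)
  renaming (∈-map⁺ to ∈-mapⱽ⁺)
open import Data.Vec.Relation.Unary.All as Allⱽ
  using ()
  renaming (All to Allⱽ; [] to []ᵃ; _∷_ to _∷ᵃ_)
open import Data.Vec.Relation.Unary.Any as Anyⱽ using () renaming (here to hereⱽ; there to thereⱽ)
import Data.Vec.Relation.Unary.Any.Properties as Anyⱽₚ
open import Data.Vec.Relation.Unary.Linked as Linkedⱽ
  using ()
  renaming (Linked to Linkedⱽ; [] to []ˡ; [-] to [-]ˡ; _∷_ to _∷ˡ_)
open import Data.Vec.Properties using (length-toList) renaming (≡-dec to ≡-decⱽ)
open import Function using (_∘_; id; case_of_)
open import Relation.Binary.Definitions using (DecidableEquality)
open import Relation.Binary.PropositionalEquality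
  using (_≡_; _≢_; refl; sym; trans; cong; cong₂; subst; subst₂; setoid; module ≡-Reasoning)
open import Relation.Nullary using (¬_; Dec; yes; no; ¬?; contradiction)
open import Relation.Nullary.Decidable using (_×-dec_; _⊎-dec_; _→-dec_; map′; decidable-stable)
open import Relation.Unary using (Pred; _≐_)
open import Level using (0ℓ)

-- Against a fixed strategy of either player it suffices to find one sequence of moves along which a
-- copy of the opponent is never without a copy of the drawing player. As the goal is a negation,
-- the sequence only has to exist up to double negation; hence the undecided questions at the end of
-- the opening (is there a threat, which order of `r` and `g` is harmless) cause no harm.
--
-- The constants come from counting. When `χ(F)` is complete, the opponent has one edge more than
-- `F`, while `H` has at least two more: he owns no copy, and a threat uses all his edges. During
-- the chase two of his edges are uncontrolled, the last one `f` and a hypothetical next one `o`;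
-- two is the number of edges that (iv) allows to delete. A vertex outside the core lies on `f`, `o`
-- and at most one edge whose partner is taken, fewer than the 4 edges at a vertex of `H` other than
-- `z`; without `o` these are fewer than the 3 at a vertex of `F`.

private
  variable
    A B : Set
    k n : ℕ

infix 4 _∈ᵉ_ _≈_⟨_⟩

_∈ᵉ_ : ℕ → Edge k → Set
v ∈ᵉ e = v ∈ⱽ elements e

-- Finite counting

lookup-injective : {xs : List A} → Unique xs → ∀ i j → lookup xs i ≡ lookup xs j → i ≡ j
lookup-injective (_ ∷ _)  zero    zero    _  = refl
lookup-injective (x∉ ∷ _) zero    (suc j) eq = contradiction eq (All.lookup x∉ (∈-lookup j))
lookup-injective (x∉ ∷ _) (suc i) zero    eq = contradiction (sym eq) (All.lookup x∉ (∈-lookup i))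
lookup-injective (_ ∷ u)  (suc i) (suc j) eq = cong suc (lookup-injective u i j eq)

-- `κ` takes the membership proof, because classes are later read off from case distinctions on how
-- an element arises.
length≤classes : ∀ {xs : List A} {j} → Unique xs → (κ : ∀ {x} → x ∈ᴸ xs → Fin j) →
  (∀ {x y} (p : x ∈ᴸ xs) (q : y ∈ᴸ xs) → κ p ≡ κ q → x ≡ y) → length xs ≤ j
length≤classes u κ κ-inj =
  injective⇒≤ {f = λ i → κ (∈-lookup i)} (λ {i} {j} eq → lookup-injective u i j (κ-inj _ _ eq))

fin-injective⇒surjective : ∀ {m n} {f : Fin m → Fin n} → (∀ {i j} → f i ≡ f j → i ≡ j) →
  n ≤ m → ∀ j → ∃ λ i → f i ≡ j
fin-injective⇒surjective {n = suc _} {f} f-inj n≤m j with any? (λ i → f i ≟ᶠ j)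
... | yes hit  = hit
... | no  miss = contradiction
  (≤-trans n≤m (injective⇒≤ {f = λ i → punchOut (λ eq → miss (i , sym eq))}
    (λ {i} {i′} eq → f-inj (punchOut-injective (λ eq → miss (i , sym eq)) (λ eq → miss (i′ , sym eq)) eq))))
  ℕₚ.1+n≰n

index-injective : ∀ {ys : List A} {x y} (p : x ∈ᴸ ys) (q : y ∈ᴸ ys) → index p ≡ index q → x ≡ y
index-injective {ys = ys} p q eq =
  trans (lookup-index p) (trans (cong (lookup ys) eq) (sym (lookup-index q)))

module _ {xs : List A} {ys : List B} (R : A → B → Set) (u : Unique xs)
         (total : ∀ {x} → x ∈ᴸ xs → ∃ λ y → y ∈ᴸ ys × R x y)
         (inj   : ∀ {x x′ y} → x ∈ᴸ xs → x′ ∈ᴸ xs → R x y → R x′ y → x ≡ x′) where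

  private
    κ : ∀ {x} → x ∈ᴸ xs → Fin (length ys)
    κ p = index (proj₁ (proj₂ (total p)))

    κ-inj : ∀ {x y} (p : x ∈ᴸ xs) (q : y ∈ᴸ xs) → κ p ≡ κ q → x ≡ y
    κ-inj p q eq with total p | total q
    ... | y , y∈ , Rxy | y′ , y′∈ , Rx′y′ with refl ← index-injective y∈ y′∈ eq = inj p q Rxy Rx′y′

  length≤length : length xs ≤ length ys
  length≤length = length≤classes u κ κ-inj

  -- Turns a bound on the number of the opponent's edges into the fact that a copy uses every one of
  -- them.
  relates-onto : length ys ≤ length xs → ∀ {y} → y ∈ᴸ ys → ∃ λ x → x ∈ᴸ xs × R x y
  relates-onto ys≤xs y∈
    with i , eq ← fin-injective⇒surjective {f = λ i → κ (∈-lookup i)}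
                    (λ {i} {j} eq → lookup-injective u i j (κ-inj _ _ eq)) ys≤xs (index y∈)
    with total (∈-lookup {xs = xs} i)
  ... | y′ , y′∈ , R-y′ with refl ← index-injective y′∈ y∈ eq = lookup xs i , ∈-lookup i , R-y′

all⊎exists : {xs : List A} {P Q : A → Set} → (∀ {x} → x ∈ᴸ xs → P x ⊎ Q x) →
  (∀ {x} → x ∈ᴸ xs → Q x) ⊎ (∃ λ x → x ∈ᴸ xs × P x)
all⊎exists {xs = []} f = inj₁ λ ()
all⊎exists {xs = x ∷ xs} f with f (here refl) | all⊎exists {xs = xs} (f ∘ there)
... | inj₁ px | _ = inj₂ (x , here refl , px)
... | inj₂ qx | inj₂ (y , y∈ , py) = inj₂ (y , there y∈ , py)
... | inj₂ qx | inj₁ q = inj₁ λ { (here refl) → qx ; (there y∈) → q y∈ }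

members : Subset n → List (Fin n)
members []            = []
members (inside ∷ p)  = zero ∷ map suc (members p)
members (outside ∷ p) = map suc (members p)

length-members : (p : Subset n) → length (members p) ≡ ∣ p ∣
length-members []            = refl
length-members (inside ∷ p)  = cong suc (trans (length-map suc (members p)) (length-members p))
length-members (outside ∷ p) = trans (length-map suc (members p)) (length-members p)

∈-members⁺ : {p : Subset n} {a : Fin n} → a ∈ p → a ∈ᴸ members p
∈-members⁺ {p = inside ∷ _}  Vec.here        = here refl
∈-members⁺ {p = inside ∷ _}  (Vec.there a∈p) = there (∈-map⁺ suc (∈-members⁺ a∈p))
∈-members⁺ {p = outside ∷ _} (Vec.there a∈p) = ∈-map⁺ suc (∈-members⁺ a∈p)

∈-members⁻ : (p : Subset n) {a : Fin n} → a ∈ᴸ members p → a ∈ p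
∈-members⁻ (inside ∷ _)  (here refl) = Vec.here
∈-members⁻ (inside ∷ p)  (there a∈) with ∈-map⁻ suc a∈
... | _ , b∈ , refl = Vec.there (∈-members⁻ p b∈)
∈-members⁻ (outside ∷ p) a∈ with ∈-map⁻ suc a∈
... | _ , b∈ , refl = Vec.there (∈-members⁻ p b∈)

members-unique : (p : Subset n) → Unique (members p)
members-unique []            = []
members-unique (inside ∷ p)  =
  All.tabulate (λ a∈ → λ { refl → case ∈-map⁻ suc a∈ of λ () }) ∷
  Uniqueₚ.map⁺ Finₚ.suc-injective (members-unique p)
members-unique (outside ∷ p) = Uniqueₚ.map⁺ Finₚ.suc-injective (members-unique p)

map-unique : {f : A → B} {xs : List A} →
  (∀ {a b} → a ∈ᴸ xs → b ∈ᴸ xs → f a ≡ f b → a ≡ b) → Unique xs → Unique (map f xs)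
map-unique inj []       = []
map-unique {f = f} inj (x∉ ∷ u) =
  Allₚ.map⁺ (All.tabulate (λ b∈ eq → All.lookup x∉ b∈ (inj (here refl) (there b∈) eq))) ∷
  map-unique (λ a∈ b∈ → inj (there a∈) (there b∈)) u

-∈⇒∈ : {p : Subset n} {a b : Fin n} → a ∈ p - b → a ∈ p
-∈⇒∈ {p = p} {b = b} = p─q⊆p p _

x∈p─q⇒x∉q : (p q : Subset n) {a : Fin n} → a ∈ p ─ q → a ∉ q
x∈p─q⇒x∉q (_ ∷ p) (_ ∷ q) (Vec.there a∈) (Vec.there a∈q) = x∈p─q⇒x∉q p q a∈ a∈q

-∈⇒≢ : {p : Subset n} {a b : Fin n} → a ∈ p - b → a ≢ b
-∈⇒≢ {p = p} {a} a∈ refl = x∈p─q⇒x∉q p _ a∈ (x∈⁅x⁆ a)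

∈⋃⇒ : (S : List (Subset n)) {a : Fin n} → a ∈ ⋃ S → ∃ λ x → x ∈ᴸ S × a ∈ x
∈⋃⇒ []      a∈ = contradiction a∈ ∉⊥
∈⋃⇒ (x ∷ S) a∈ with x∈p∪q⁻ x (⋃ S) a∈
... | inj₁ a∈x = x , here refl , a∈x
... | inj₂ a∈S with y , y∈ , a∈y ← ∈⋃⇒ S a∈S = y , there y∈ , a∈y

-- Edges as finite sets

edge≡ : {e e′ : Edge k} → elements e ≡ elements e′ → e ≡ e′
edge≡ {e = edge xs p} {edge .xs q} refl = cong (edge xs) (Linkedⱽ.irrelevant <-irrelevant p q)

_≟ᵉ_ : DecidableEquality (Edge k)
e ≟ᵉ e′ = map′ edge≡ (cong elements) (≡-decⱽ _≟ℕ_ (elements e) (elements e′))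

tail-increasing : ∀ {x} {xs : Vec ℕ n} → Linkedⱽ _<_ (x ∷ xs) → Linkedⱽ _<_ xs
tail-increasing [-]ˡ      = []ˡ
tail-increasing (_ ∷ˡ ps) = ps

head-minimal : ∀ {x y} {xs : Vec ℕ n} → Linkedⱽ _<_ (x ∷ xs) → y ∈ⱽ xs → x < y
head-minimal (x<y ∷ˡ _)  (hereⱽ refl)  = x<y
head-minimal (x<y ∷ˡ ps) (thereⱽ y∈) = ℕₚ.<-trans x<y (head-minimal ps y∈)

increasing-ext : {xs ys : Vec ℕ n} → Linkedⱽ _<_ xs → Linkedⱽ _<_ ys →
  (∀ {v} → v ∈ⱽ xs → v ∈ⱽ ys) → (∀ {v} → v ∈ⱽ ys → v ∈ⱽ xs) → xs ≡ ys
increasing-ext {xs = []}     {[]}     _ _ _ _ = refl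
increasing-ext {xs = x ∷ xs} {y ∷ ys} p q f g with f (hereⱽ refl) | g (hereⱽ refl)
... | thereⱽ x∈ | thereⱽ y∈ = contradiction (head-minimal p y∈) (ℕₚ.<-asym (head-minimal q x∈))
... | thereⱽ x∈ | hereⱽ refl = contradiction (head-minimal q x∈) (<-irrefl refl)
... | hereⱽ refl | _ = cong (x ∷_) (increasing-ext (tail-increasing p) (tail-increasing q)
        (λ v∈ → strip (head-minimal p v∈) (f (thereⱽ v∈))) (λ v∈ → strip (head-minimal q v∈) (g (thereⱽ v∈))))
  where
  strip : ∀ {m v} {zs : Vec ℕ m} → x < v → v ∈ⱽ x ∷ zs → v ∈ⱽ zs
  strip x<x (hereⱽ refl) = contradiction x<x (<-irrefl refl)
  strip _   (thereⱽ v∈)  = v∈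

edge-ext : {e e′ : Edge k} → (∀ {v} → v ∈ᵉ e → v ∈ᵉ e′) → (∀ {v} → v ∈ᵉ e′ → v ∈ᵉ e) → e ≡ e′
edge-ext {e = e} {e′} f g = edge≡ (increasing-ext (increasing e) (increasing e′) f g)

_∈ᵉ?_ : ∀ v (e : Edge k) → Dec (v ∈ᵉ e)
v ∈ᵉ? e = Anyⱽ.any? (v ≟ℕ_) (elements e)

strictly-increasing : ∀ {xs} → Linked _≤_ xs → Unique xs → Linkedⱽ _<_ (Vec.fromList xs)
strictly-increasing []       _               = []ˡ
strictly-increasing [-]      _               = [-]ˡ
strictly-increasing (p ∷ ps) ((x≢y ∷ _) ∷ u) = ≤∧≢⇒< p x≢y ∷ˡ strictly-increasing ps u

fromSorted : ∀ {xs} → Linked _≤_ xs → Unique xs → length xs ≡ k →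
  ∃ λ (e : Edge k) → (∀ {v} → v ∈ᵉ e → v ∈ᴸ xs) × (∀ {v} → v ∈ᴸ xs → v ∈ᵉ e)
fromSorted {xs = xs} ps u refl = edge (Vec.fromList xs) (strictly-increasing ps u) , ∈-fromList⁻ , ∈-fromList⁺

fromUnique : (xs : List ℕ) → Unique xs → length xs ≡ k →
  ∃ λ (e : Edge k) → (∀ {v} → v ∈ᵉ e → v ∈ᴸ xs) × (∀ {v} → v ∈ᴸ xs → v ∈ᵉ e)
fromUnique xs u len =
  let e , to , from = fromSorted (sort-↗ ≤-decTotalOrder xs)
        (Permutation.Unique-resp-↭ (setoid ℕ) (↭⇒↭ₛ (↭-sym sorted)) u)
        (trans (↭-length sorted) len)
  in e , (λ v∈ → ∈-resp-↭ sorted (to v∈)) , (λ v∈ → from (∈-resp-↭ (↭-sym sorted) v∈))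
  where
  sorted = sort-↭ ≤-decTotalOrder xs

-- Images of vertex sets

-- A record, so that Agda can infer e from a proof of e ≈ φ ⟨ x ⟩.
record _≈_⟨_⟩ (e : Edge k) (φ : Fin n → ℕ) (x : Subset n) : Set where
  constructor isImage
  field
    preimage : ∀ {v} → v ∈ᵉ e → Image φ x v
    covers   : ∀ {a} → a ∈ x → φ a ∈ᵉ e

open _≈_⟨_⟩ public

fromImage : ∀ {φ : Fin n → ℕ} {x} (e : Edge k) → (_∈ⱽ elements e) ≐ Image φ x → e ≈ φ ⟨ x ⟩
fromImage _ (f , g) = isImage f (λ a∈ → g (_ , a∈ , refl))

toImage : ∀ {φ : Fin n → ℕ} {x} {e : Edge k} → e ≈ φ ⟨ x ⟩ → (_∈ⱽ elements e) ≐ Image φ x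
toImage p = preimage p , λ { (_ , a∈ , refl) → covers p a∈ }

image-unique : ∀ {φ : Fin n → ℕ} {x} {e e′ : Edge k} → e ≈ φ ⟨ x ⟩ → e′ ≈ φ ⟨ x ⟩ → e ≡ e′
image-unique p q = edge-ext (λ v∈ → proj₂ (toImage q) (preimage p v∈)) (λ v∈ → proj₂ (toImage p) (preimage q v∈))

image-cong : ∀ {φ ψ : Fin n → ℕ} {x} {e : Edge k} → (∀ {a} → a ∈ x → φ a ≡ ψ a) →
  e ≈ φ ⟨ x ⟩ → e ≈ ψ ⟨ x ⟩
image-cong {e = e} eq p = isImage
  (λ v∈ → let a , a∈ , q = preimage p v∈ in a , a∈ , trans (sym (eq a∈)) q)
  (λ a∈ → subst (_∈ᵉ e) (eq a∈) (covers p a∈))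

module _ {U : Subset n} {φ : Fin n → ℕ} (φ-inj : InjectiveOn U φ) where

  image-reflects-∈ : ∀ {x a} {e : Edge k} → x ⊆ U → e ≈ φ ⟨ x ⟩ → a ∈ U → φ a ∈ᵉ e → a ∈ x
  image-reflects-∈ x⊆U p a∈U φa∈ with b , b∈x , eq ← preimage p φa∈ =
    subst (_∈ _) (φ-inj (x⊆U b∈x) a∈U eq) b∈x

  image-injective : ∀ {x y} {e : Edge k} → x ⊆ U → y ⊆ U → e ≈ φ ⟨ x ⟩ → e ≈ φ ⟨ y ⟩ → x ≡ y
  image-injective x⊆U y⊆U p q = ⊆-antisym
    (λ a∈ → image-reflects-∈ y⊆U q (x⊆U a∈) (covers p a∈))
    (λ a∈ → image-reflects-∈ x⊆U p (y⊆U a∈) (covers q a∈))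

image : (φ : Fin n → ℕ) (x : Subset n) → ∣ x ∣ ≡ k → InjectiveOn x φ → ∃ λ (e : Edge k) → e ≈ φ ⟨ x ⟩
image φ x ∣x∣≡k inj =
  let e , to , from = fromUnique (map φ (members x))
        (map-unique (λ a∈ b∈ → inj (∈-members⁻ x a∈) (∈-members⁻ x b∈)) (members-unique x))
        (trans (length-map φ (members x)) (trans (length-members x) ∣x∣≡k))
  in e , isImage (λ v∈ → let a , a∈ , eq = ∈-map⁻ φ (to v∈) in a , ∈-members⁻ x a∈ , sym eq)
                 (λ a∈ → from (∈-map⁺ φ (∈-members⁺ a∈)))

image? : (φ : Fin n → ℕ) (x : Subset n) (v : ℕ) → Dec (Image φ x v)
image? φ x v = any? (λ a → (a ∈? x) ×-dec (φ a ≟ℕ v))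

tabulateⱽ : ∀ {P : ℕ → Set} (xs : Vec ℕ n) → (∀ {v} → v ∈ⱽ xs → P v) → Allⱽ P xs
tabulateⱽ []       f = []ᵃ
tabulateⱽ (_ ∷ xs) f = f (hereⱽ refl) ∷ᵃ tabulateⱽ xs (f ∘ thereⱽ)

isImage? : (e : Edge k) (φ : Fin n → ℕ) (x : Subset n) → Dec (e ≈ φ ⟨ x ⟩)
isImage? e φ x =
  map′ (λ (p , q) → isImage (Allⱽ.lookup p) (q _))
       (λ p → tabulateⱽ (elements e) (preimage p) , λ a → covers p)
       (Allⱽ.all? (image? φ x) (elements e) ×-dec all? (λ a → (a ∈? x) →-dec (φ a ∈ᵉ? e)))

-- Building a play from the moves of both sides

interleave : (f g : ℕ → A) → ℕ → A
interleave f g zero    = f 0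
interleave f g (suc t) = interleave g (f ∘ suc) t

2*suc : ∀ i → 2 * suc i ≡ 2 + 2 * i
2*suc i = ℕₚ.*-suc 2 i

interleave-even : ∀ (f g : ℕ → A) i → interleave f g (2 * i) ≡ f i
interleave-even f g zero    = refl
interleave-even f g (suc i) =
  trans (cong (interleave f g) (2*suc i)) (interleave-even (f ∘ suc) (g ∘ suc) i)

interleave-odd : ∀ (f g : ℕ → A) i → interleave f g (suc (2 * i)) ≡ g i
interleave-odd f g = interleave-even g (f ∘ suc)

half : ∀ t → ∃ λ i → t ≡ 2 * i ⊎ t ≡ suc (2 * i)
half zero    = 0 , inj₁ refl
half (suc t) with half t
... | i , inj₁ eq = i , inj₂ (cong suc eq)
... | i , inj₂ eq = suc i , inj₁ (trans (cong suc eq) (sym (2*suc i)))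

turn-suc : ∀ P i → turn P (suc i) ≡ 2 + turn P i
turn-suc FP i = 2*suc i
turn-suc SP i = cong suc (2*suc i)

opening : Edge k → Player → List (Edge k)
opening x FP = []
opening x SP = x ∷ []

module _ (P : Player) (σ : Strategy k) (x : Edge k) (h : ℕ → List (Edge k)) (a : ℕ → Edge k) where

  record PlayedOut : Set where
    field
      play    : Play k
      allowed : Legal play
      follows : Follows P σ play
      own     : ∀ i → play (turn P i) ≡ move σ (h i)
      other   : ∀ i → play (suc (turn P i)) ≡ a i
      first   : P ≡ SP → play 0 ≡ x

  -- Serves two simulations: of the fast strategy on a shifted board, and of the supposed winning
  -- strategy against the drawing player. `h i` is the history before move `i` of `P`, and `a i` the
  -- reply to that move; `x` comes before them all if `P` moves second.
  play-out : h 0 ≡ opening x P → (∀ i → h (suc i) ≡ h i ++ move σ (h i) ∷ a i ∷ []) →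
    (∀ i → a i ∉ᴸ h i ++ move σ (h i) ∷ []) → PlayedOut
  play-out h-zero h-suc a-legal = build P refl
    where
    m = λ i → move σ (h i)

    module Build (p : Play k) (own : ∀ i → p (turn P i) ≡ m i) (other : ∀ i → p (suc (turn P i)) ≡ a i)
                 (start : history p (turn P 0) ≡ opening x P)
                 -- The left alternative is for move 0 when `P` is `SP`: `x` is played before any
                 -- turn of `P`.
                 (split : ∀ t → p t ∉ᴸ history p t ⊎ (∃ λ i → t ≡ turn P i ⊎ t ≡ suc (turn P i)))
                 (first : P ≡ SP → p 0 ≡ x) where

      history-suc : ∀ t → history p (suc t) ≡ history p t ++ p t ∷ []
      history-suc t = sym (applyUpTo-∷ʳ p t)

      history≡ : ∀ i → history p (turn P i) ≡ h i
      history≡ zero    = trans start (sym h-zero)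
      history≡ (suc i) = begin
        history p (turn P (suc i))                          ≡⟨ cong (history p) (turn-suc P i) ⟩
        history p (2 + t)                                   ≡⟨ history-suc (suc t) ⟩
        history p (suc t) ++ p (suc t) ∷ []                 ≡⟨ cong (_++ p (suc t) ∷ []) (history-suc t) ⟩
        (history p t ++ p t ∷ []) ++ p (suc t) ∷ []         ≡⟨ ++-assoc (history p t) _ _ ⟩
        history p t ++ p t ∷ p (suc t) ∷ []                 ≡⟨ cong₂ (λ l e → l ++ e ∷ p (suc t) ∷ []) (history≡ i) (own i) ⟩
        h i ++ m i ∷ p (suc t) ∷ []                         ≡⟨ cong (λ e → h i ++ m i ∷ e ∷ []) (other i) ⟩
        h i ++ m i ∷ a i ∷ []                               ≡⟨ sym (h-suc i) ⟩
        h (suc i)                                           ∎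
        where
        open ≡-Reasoning
        t = turn P i

      p-legal : Legal p
      p-legal t with split t
      ... | inj₁ ok = ok
      ... | inj₂ (i , inj₁ refl) = subst₂ _∉ᴸ_ (sym (own i)) (sym (history≡ i)) (Strategy.legal σ (h i))
      ... | inj₂ (i , inj₂ refl) = subst₂ _∉ᴸ_ (sym (other i))
        (sym (trans (history-suc (turn P i)) (cong₂ (λ l e → l ++ e ∷ []) (history≡ i) (own i)))) (a-legal i)

      result : PlayedOut
      result = record
        { play = p ; allowed = p-legal ; own = own ; other = other ; first = first
        ; follows = λ i → trans (own i) (cong (move σ) (sym (history≡ i))) }

    build : ∀ Q → Q ≡ P → PlayedOut
    build FP refl = Build.result (interleave m a) (interleave-even m a) (interleave-odd m a) refl
      (λ t → inj₂ (half t)) λ ()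
    build SP refl = Build.result (interleave x∷a m) (interleave-odd x∷a m) (interleave-even a (m ∘ suc)) refl
      split λ _ → refl
      where
      x∷a : ℕ → Edge _
      x∷a zero    = x
      x∷a (suc i) = a i

      split : ∀ t → interleave x∷a m t ∉ᴸ history (interleave x∷a m) t ⊎
        (∃ λ i → t ≡ turn SP i ⊎ t ≡ suc (turn SP i))
      split zero    = inj₁ λ ()
      split (suc t) with half t
      ... | i , inj₁ refl = inj₂ (i , inj₁ refl)
      ... | i , inj₂ refl = inj₂ (i , inj₂ refl)

-- Degrees, and embeddings into a list of edges

nonempty⇒∃ : {xs : List A} → 1 ≤ length xs → ∃ λ x → x ∈ᴸ xs
nonempty⇒∃ {xs = x ∷ _} _ = x , here refl

increasing-unique : {xs : Vec ℕ n} → Linkedⱽ _<_ xs → Unique (Vec.toList xs)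
increasing-unique {xs = []}    _ = []
increasing-unique {xs = _ ∷ _} p =
  All.tabulate (λ y∈ → ℕₚ.<⇒≢ (head-minimal p (∈-toList⁻ y∈))) ∷ increasing-unique (tail-increasing p)

module _ {k n : ℕ} (H : Hypergraph k n) where

  edge⊆V : ∀ {x} → x ∈ᴸ E H → x ⊆ V H
  edge⊆V x∈ = All.lookup (E⊆V H) x∈

  edge-size : ∀ {x} → x ∈ᴸ E H → ∣ x ∣ ≡ k
  edge-size = All.lookup (uniform H)

  degree≤classes : ∀ {a j} (C : Fin j → Subset n → Set) →
    (∀ {x} → x ∈ᴸ E H → a ∈ x → ∃ λ i → C i x) →
    (∀ i {x y} → x ∈ᴸ E H → y ∈ᴸ E H → a ∈ x → a ∈ y → C i x → C i y → x ≡ y) →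
    degree H a ≤ j
  degree≤classes {a} C classify same =
    length≤classes (Uniqueₚ.filter⁺ (a ∈?_) (unique H))
      (λ p → proj₁ (class p)) (λ p q eq → same-class p q eq)
    where
    class : ∀ {x} → x ∈ᴸ filter (a ∈?_) (E H) → ∃ λ i → C i x
    class p = let x∈ , a∈x = ∈-filter⁻ (a ∈?_) p in classify x∈ a∈x

    same-class : ∀ {x y} (p : x ∈ᴸ filter (a ∈?_) (E H)) (q : y ∈ᴸ filter (a ∈?_) (E H)) →
      proj₁ (class p) ≡ proj₁ (class q) → x ≡ y
    same-class p q eq with class p | class q
    same-class p q refl | i , cx | .i , cy =
      let x∈ , a∈x = ∈-filter⁻ (a ∈?_) p
          y∈ , a∈y = ∈-filter⁻ (a ∈?_) q
      in same i x∈ y∈ a∈x a∈y cx cy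

  δ≤degree : ∀ {a} → a ∈ V H → δ H ≤ degree H a
  δ≤degree {a} a∈V = f[argmin]≤v⁺ {f = id} (length (E H)) _
    (inj₂ (lose (∈-map⁺ (degree H) (∈-filter⁺ (_∈? V H) (∈-allFin a) a∈V)) ≤-refl))

  degree≥1⇒covered : ∀ {a} → 1 ≤ degree H a → ∃ λ x → x ∈ᴸ E H × a ∈ x
  degree≥1⇒covered {a} p with x , x∈ ← nonempty⇒∃ p = x , ∈-filter⁻ (a ∈?_) x∈

module _ {k n : ℕ} (H : Hypergraph k n) {ψ : Fin n → ℕ} (ψ-inj : InjectiveOn (V H) ψ)
         {L : List (Edge k)} (embeds : ∀ {x} → x ∈ᴸ E H → ∃ λ e → e ∈ᴸ L × e ≈ ψ ⟨ x ⟩) where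

  private
    image-inj : ∀ {x x′} {e : Edge k} → x ∈ᴸ E H → x′ ∈ᴸ E H → e ≈ ψ ⟨ x ⟩ → e ≈ ψ ⟨ x′ ⟩ → x ≡ x′
    image-inj x∈ x′∈ = image-injective ψ-inj (edge⊆V H x∈) (edge⊆V H x′∈)

  embedding-size : length (E H) ≤ length L
  embedding-size = length≤length (λ x (e : Edge k) → e ≈ ψ ⟨ x ⟩) (unique H) embeds image-inj

  embedding-onto : length L ≤ length (E H) → ∀ {e} → e ∈ᴸ L → ∃ λ x → x ∈ᴸ E H × e ≈ ψ ⟨ x ⟩
  embedding-onto = relates-onto (λ x (e : Edge k) → e ≈ ψ ⟨ x ⟩) (unique H) embeds image-inj

-- The hypotheses on `H` and their immediate consequences

module Setting {k n : ℕ} (2≤k : 2 ≤ k) (H : Hypergraph k n)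
  (z : Fin n) (z∈V : z ∈ V H) (deg-z : degree H z ≡ 2)
  (r g : Subset n) (r∈E : r ∈ᴸ E H) (g∈E : g ∈ᴸ E H) (r≢g : r ≢ g) (z∈r : z ∈ r) (z∈g : z ∈ g)
  (δ≥3 : 3 ≤ δ (H ∖ᵛ z))
  (deg≥4 : ∀ u → u ∈ V H → u ≢ z → 4 ≤ degree H u)
  (rigid : ∀ e e′ → e ∈ᴸ E H → e′ ∈ᴸ E H → e ≢ e′ →
    ∀ φ → Monomorphism (H ∖ᴱ (e ∷ e′ ∷ [])) H φ →
    ∀ a → a ∈ V (H ∖ᴱ (e ∷ e′ ∷ [])) → φ a ≡ a)
  (meets : ∀ e → e ∈ᴸ E H → Nonempty (e ∩ r) × Nonempty (e ∩ g))
  (few : ∣ V H ─ (r ∪ g) ∣ < k ∸ 1) where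

  _≟_ : DecidableEquality (Subset n)
  _≟_ = _≟ˢ_ {k}

  F : Hypergraph k n
  F = H ∖ᵛ z

  V⁻ : Subset n
  V⁻ = V H - z

  F⁺ : ∀ {x} → x ∈ᴸ E H → z ∉ x → x ∈ᴸ E F
  F⁺ = ∈-filter⁺ _

  F⁻ : ∀ {x} → x ∈ᴸ E F → x ∈ᴸ E H × z ∉ x
  F⁻ = ∈-filter⁻ (λ e → ¬? (z ∈? e))

  V⁻⊆V : V⁻ ⊆ V H
  V⁻⊆V = -∈⇒∈

  -- Statements over `Pair w w′` treat both orders of `r` and `g` at once, so it stays open which of
  -- them serves as the threat.
  data Pair : Subset n → Subset n → Set where
    rg : Pair r g
    gr : Pair g r

  flip-pair : ∀ {w w′} → Pair w w′ → Pair w′ w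
  flip-pair rg = gr
  flip-pair gr = rg

  pair-∈E : ∀ {w w′} → Pair w w′ → w ∈ᴸ E H
  pair-∈E rg = r∈E
  pair-∈E gr = g∈E

  z∈pair : ∀ {w w′} → Pair w w′ → z ∈ w
  z∈pair rg = z∈r
  z∈pair gr = z∈g

  pair-≢ : ∀ {w w′} → Pair w w′ → w ≢ w′
  pair-≢ rg = r≢g
  pair-≢ gr = r≢g ∘ sym

  z-edge : ∀ {x} → x ∈ᴸ E H → z ∈ x → ∃ λ x′ → Pair x x′
  z-edge {x} x∈ z∈x with x ≟ r | x ≟ g
  ... | yes refl | _        = g , rg
  ... | no _     | yes refl = r , gr
  ... | no x≢r   | no x≢g   = contradiction three≤two λ { (s≤s (s≤s ())) }
    where
    three≤two : 3 ≤ 2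
    three≤two = subst (3 ≤_) deg-z (length≤length _≡_
      ((x≢r ∷ x≢g ∷ []) ∷ (r≢g ∷ []) ∷ [] ∷ [])
      (λ { (here refl) → _ , ∈-filter⁺ (z ∈?_) x∈ z∈x , refl
         ; (there (here refl)) → _ , ∈-filter⁺ (z ∈?_) r∈E z∈r , refl
         ; (there (there (here refl))) → _ , ∈-filter⁺ (z ∈?_) g∈E z∈g , refl })
      (λ _ _ p q → trans p (sym q)))

  same-pair : ∀ {w w′ x x′} → Pair w w′ → Pair x x′ → (w ≡ x × w′ ≡ x′) ⊎ (w ≡ x′ × w′ ≡ x)
  same-pair rg rg = inj₁ (refl , refl)
  same-pair rg gr = inj₂ (refl , refl)
  same-pair gr rg = inj₂ (refl , refl)
  same-pair gr gr = inj₁ (refl , refl)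

  -- The margin comes from `r` and `g`. Because of it, one edge more than `F` has is still too few
  -- for a copy of `H`.
  size-F : 2 + length (E F) ≤ length (E H)
  size-F = length≤length _≡_
    ((r≢g ∷ All.tabulate (λ x∈ → λ { refl → proj₂ (F⁻ x∈) z∈r })) ∷
      All.tabulate (λ x∈ → λ { refl → proj₂ (F⁻ x∈) z∈g }) ∷ unique F)
    (λ { (here refl) → _ , r∈E , refl
       ; (there (here refl)) → _ , g∈E , refl
       ; (there (there x∈)) → _ , proj₁ (F⁻ x∈) , refl })
    (λ _ _ p q → trans p (sym q))

  ≥4-classes : ∀ {a} → a ∈ V H → a ≢ z → (C : Fin 3 → Subset n → Set) →
    (∀ {x} → x ∈ᴸ E H → a ∈ x → ∃ λ i → C i x) →
    ¬ (∀ i {x y} → x ∈ᴸ E H → y ∈ᴸ E H → a ∈ x → a ∈ y → C i x → C i y → x ≡ y)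
  ≥4-classes a∈V a≢z C classify same =
    contradiction (≤-trans (deg≥4 _ a∈V a≢z) (degree≤classes H C classify same)) λ { (s≤s (s≤s (s≤s ()))) }

  ≥3-classes : ∀ {a} → a ∈ V⁻ → (C : Fin 2 → Subset n → Set) →
    (∀ {x} → x ∈ᴸ E F → a ∈ x → ∃ λ i → C i x) →
    ¬ (∀ i {x y} → x ∈ᴸ E F → y ∈ᴸ E F → a ∈ x → a ∈ y → C i x → C i y → x ≡ y)
  ≥3-classes a∈ C classify same =
    contradiction (≤-trans δ≥3 (≤-trans (δ≤degree F a∈) (degree≤classes F C classify same))) λ { (s≤s (s≤s ())) }

  F-covers : ∀ {a} → a ∈ V⁻ → ∃ λ x → x ∈ᴸ E F × a ∈ x
  F-covers a∈ = degree≥1⇒covered F (≤-trans (s≤s z≤n) (≤-trans δ≥3 (δ≤degree F a∈)))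

  -- Rigidity only speaks of vertices that survive the removal of two edges. The degree bound lets
  -- all vertices but `z` survive; removing `r` and `g` isolates `z`.
  covered-outside : ∀ {a} d d′ → a ∈ V H → a ≢ z → ∃ λ x → x ∈ᴸ E H × a ∈ x × x ≢ d × x ≢ d′
  covered-outside {a} d d′ a∈V a≢z
    with Any.any? (λ x → (a ∈? x) ×-dec (¬? (x ≟ d) ×-dec ¬? (x ≟ d′))) (E H)
  ... | yes p with x , x∈ , q ← find p = x , x∈ , q
  ... | no ¬p = ⊥-elim (≥4-classes a∈V a≢z C classify same)
    where
    C : Fin 3 → Subset n → Set
    C zero          x = x ≡ d
    C (suc zero)    x = x ≡ d′
    C (suc (suc _)) x = ⊥

    classify : ∀ {x} → x ∈ᴸ E H → a ∈ x → ∃ λ i → C i x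
    classify {x} x∈ a∈x with x ≟ d | x ≟ d′
    ... | yes eq | _      = zero , eq
    ... | no _   | yes eq = suc zero , eq
    ... | no x≢d | no x≢d′ = contradiction (lose x∈ (a∈x , x≢d , x≢d′)) ¬p

    same : ∀ i {x y} → x ∈ᴸ E H → y ∈ᴸ E H → a ∈ x → a ∈ y → C i x → C i y → x ≡ y
    same zero       _ _ _ _ p q = trans p (sym q)
    same (suc zero) _ _ _ _ p q = trans p (sym q)

  -- Rigidity, for maps into the board

  private
    -- The partial map `φ⁻¹ ∘ ψ`. The fallback `a` is reached only if `ψ a` is outside `φ(U)`, hence
    -- never at the vertices to which rigidity is applied.
    pull : Subset n → (φ ψ : Fin n → ℕ) → Fin n → Fin n
    pull U φ ψ a with any? (λ b → (b ∈? U) ×-dec (φ b ≟ℕ ψ a))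
    ... | yes (b , _) = b
    ... | no _        = a

    pull-spec : ∀ {U φ ψ a} → Image φ U (ψ a) → pull U φ ψ a ∈ U × φ (pull U φ ψ a) ≡ ψ a
    pull-spec {U} {φ} {ψ} {a} im with any? (λ b → (b ∈? U) ×-dec (φ b ≟ℕ ψ a))
    ... | yes (_ , p) = p
    ... | no ¬im      = contradiction im ¬im

  Matched : Subset n → (φ ψ : Fin n → ℕ) → Subset n → Set
  Matched U φ ψ x = ∃ λ y → y ∈ᴸ E H × y ⊆ U × ∃ λ (e : Edge k) → e ≈ ψ ⟨ x ⟩ × e ≈ φ ⟨ y ⟩

  -- As `ψ` maps all edges but `d` and `d′` to edges of `φ(H)`, the map `φ⁻¹ ∘ ψ` is a monomorphism
  -- of `H ∖ᴱ (d ∷ d′ ∷ [])` into `H`, hence the identity. For two copies of `F` both `U` and `W`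
  -- are `V⁻`.
  rigidity : ∀ {U W φ ψ d d′} → U ⊆ V H → InjectiveOn U φ → InjectiveOn W ψ →
    d ∈ᴸ E H → d′ ∈ᴸ E H → d ≢ d′ →
    (∀ {x} → x ∈ᴸ E H → x ≢ d → x ≢ d′ → x ⊆ W × Matched U φ ψ x) →
    ∀ {a} → a ∈ V H → a ≢ z → ψ a ≡ φ a
  rigidity {U} {W} {φ} {ψ} {d} {d′} U⊆V φ-inj ψ-inj d∈ d′∈ d≢d′ match {a} a∈V a≢z =
    let x , x∈ , a∈x , x≢d , x≢d′ = covered-outside d d′ a∈V a≢z
        a∈⋃ = ⊆⋃ {k} (E G) (∈-filter⁺ _ x∈ (λ { (here eq) → x≢d eq ; (there (here eq)) → x≢d′ eq })) a∈x
    in trans (sym (proj₂ (spec a∈⋃))) (cong φ (rigid d d′ d∈ d′∈ d≢d′ θ mono a a∈⋃))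
    where
    G = H ∖ᴱ (d ∷ d′ ∷ [])
    θ = pull U φ ψ

    G⁻ : ∀ {x} → x ∈ᴸ E G → x ∈ᴸ E H × x ≢ d × x ≢ d′
    G⁻ x∈ with x∈E , x∉ ← ∈-filter⁻ (λ e → ¬? (DecMembership._∈?_ _≟_ e (d ∷ d′ ∷ []))) x∈ =
      x∈E , (λ eq → x∉ (here eq)) , (λ eq → x∉ (there (here eq)))

    matched : ∀ {x} → x ∈ᴸ E G → x ⊆ W × Matched U φ ψ x
    matched x∈ = let x∈E , x≢d , x≢d′ = G⁻ x∈ in match x∈E x≢d x≢d′

    spec-edge : ∀ {x a} → x ∈ᴸ E G → a ∈ x → θ a ∈ U × φ (θ a) ≡ ψ a
    spec-edge {x} {a} x∈ a∈x =
      let _ , y , y∈ , y⊆U , e , e≈x , e≈y = matched x∈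
          b , b∈y , eq = preimage e≈y (covers e≈x a∈x)
      in pull-spec {U} {φ} {ψ} (b , y⊆U b∈y , eq)

    spec : ∀ {a} → a ∈ V G → θ a ∈ U × φ (θ a) ≡ ψ a
    spec a∈ = let x , x∈ , a∈x = ∈⋃⇒ (E G) a∈ in spec-edge x∈ a∈x

    V-G⊆W : V G ⊆ W
    V-G⊆W a∈ = let x , x∈ , a∈x = ∈⋃⇒ (E G) a∈ in proj₁ (matched x∈) a∈x

    mono : Monomorphism G H θ
    mono = record
      { maps-V    = λ a∈ → U⊆V (proj₁ (spec a∈))
      ; injective = λ a∈ b∈ eq → ψ-inj (V-G⊆W a∈) (V-G⊆W b∈)
          (trans (sym (proj₂ (spec a∈))) (trans (cong φ eq) (proj₂ (spec b∈))))
      ; maps-E    = λ {x} x∈ →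
          let x⊆W , y , y∈ , y⊆U , e , e≈x , e≈y = matched x∈ in
          y , y∈ ,
          (λ {c} c∈y → let a , a∈x , ψa≡φc = preimage e≈x (covers e≈y c∈y)
                           θa∈U , φθa≡ψa = spec-edge x∈ a∈x
                       in a , a∈x , φ-inj θa∈U (y⊆U c∈y) (trans φθa≡ψa ψa≡φc)) ,
          (λ { (a , a∈x , refl) →
                 let θa∈U , φθa≡ψa = spec-edge x∈ a∈x
                 in image-reflects-∈ φ-inj y⊆U e≈y θa∈U (subst (_∈ᵉ e) (sym φθa≡ψa) (covers e≈x a∈x)) })
      }

  -- By injectivity `f` and `o` are each the image of at most one edge; these are the two edges to
  -- delete.
  rigidity₂ : ∀ {U φ ψ} (f o : Edge k) → U ⊆ V H → InjectiveOn U φ → InjectiveOn (V H) ψ →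
    (∀ {x} → x ∈ᴸ E H → f ≈ ψ ⟨ x ⟩ ⊎ o ≈ ψ ⟨ x ⟩ ⊎ Matched U φ ψ x) →
    ∀ {a} → a ∈ V H → a ≢ z → ψ a ≡ φ a
  rigidity₂ {U} {φ} {ψ} f o U⊆V φ-inj ψ-inj classify =
    let d , d∈ , except-d = remove (λ x → o ≈ ψ ⟨ x ⟩ ⊎ Matched U φ ψ x) f classify
        d′ , d′∈ , except-d′ = remove (λ x → x ≡ d ⊎ Matched U φ ψ x) o (λ {x} x∈ → second (x ≟ d) (except-d x∈))
        d″ , d″∈ , d≢d″ , except-d″ = distinct d d′ d′∈ (λ x → x ≡ d ⊎ Matched U φ ψ x) except-d′
    in rigidity U⊆V φ-inj ψ-inj d∈ d″∈ d≢d″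
         (λ x∈ x≢d x≢d″ → edge⊆V H x∈ , [ (λ x≡d → contradiction x≡d x≢d) , id ]′ (except-d″ x∈ x≢d″ x≢d))
    where
    remove : ∀ (P : Subset n → Set) (f : Edge k) → (∀ {x} → x ∈ᴸ E H → f ≈ ψ ⟨ x ⟩ ⊎ P x) →
      ∃ λ d → d ∈ᴸ E H × (∀ {x} → x ∈ᴸ E H → x ≢ d → P x)
    remove _ _ c with all⊎exists c
    ... | inj₁ all-P = r , r∈E , λ x∈ _ → all-P x∈
    ... | inj₂ (d , d∈ , f≈d) = d , d∈ , λ x∈ x≢d → case c x∈ of λ
      { (inj₁ f≈x) → contradiction (image-injective ψ-inj (edge⊆V H x∈) (edge⊆V H d∈) f≈x f≈d) x≢d
      ; (inj₂ p)   → p }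

    second : ∀ {x d} {P Q : Set} → Dec (x ≡ d) → (x ≢ d → P ⊎ Q) → P ⊎ (x ≡ d ⊎ Q)
    second (yes eq)  _ = inj₂ (inj₁ eq)
    second (no x≢d) c = [ inj₁ , inj₂ ∘ inj₂ ]′ (c x≢d)

    -- (iv) needs two different edges. Deleting more than required does no harm, so `r` or `g` takes
    -- the second place if `d` and `d′` agree.
    distinct : ∀ d d′ → d′ ∈ᴸ E H → (P : Subset n → Set) → (∀ {x} → x ∈ᴸ E H → x ≢ d′ → P x) →
      ∃ λ d″ → d″ ∈ᴸ E H × d ≢ d″ × (∀ {x} → x ∈ᴸ E H → x ≢ d″ → x ≢ d → P x)
    distinct d d′ d′∈ _ p with d ≟ d′ | d ≟ r
    ... | no d≢d′  | _        = d′ , d′∈ , d≢d′ , λ x∈ x≢d′ _ → p x∈ x≢d′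
    ... | yes refl | no d≢r   = r , r∈E , d≢r , λ x∈ _ x≢d → p x∈ x≢d
    ... | yes refl | yes refl = g , g∈E , r≢g , λ x∈ _ x≢d → p x∈ x≢d

  -- Moving `z` to a vertex of the board, and the vertex count behind (vi)

  extend : (Fin n → ℕ) → ℕ → Fin n → ℕ
  extend φ v a with a ≟ᶠ z
  ... | yes _ = v
  ... | no _  = φ a

  extend-z : ∀ φ v → extend φ v z ≡ v
  extend-z φ v with z ≟ᶠ z
  ... | yes _  = refl
  ... | no z≢z = contradiction refl z≢z

  extend-≢ : ∀ {φ v a} → a ≢ z → extend φ v a ≡ φ a
  extend-≢ {a = a} a≢z with a ≟ᶠ z
  ... | yes a≡z = contradiction a≡z a≢z
  ... | no _    = refl

  extend-injective : ∀ {φ v} → InjectiveOn V⁻ φ → ¬ Image φ V⁻ v → InjectiveOn (V H) (extend φ v)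
  extend-injective φ-inj v∉ {a} {b} a∈ b∈ eq with a ≟ᶠ z | b ≟ᶠ z
  ... | yes refl | yes refl = refl
  ... | yes refl | no b≢z   = contradiction (b , x∈p∧x≢y⇒x∈p-y b∈ b≢z , sym eq) v∉
  ... | no a≢z   | yes refl = contradiction (a , x∈p∧x≢y⇒x∈p-y a∈ a≢z , eq) v∉
  ... | no a≢z   | no b≢z   = φ-inj (x∈p∧x≢y⇒x∈p-y a∈ a≢z) (x∈p∧x≢y⇒x∈p-y b∈ b≢z) eq

  -- `φ(V H)` would have to hold the `k` vertices of `e₁` and, disjoint from them, those of `χ(S)`.
  -- As `V H` consists of `z`, `S` and `V H ─ (r ∪ g)`, this gives `k ≤ 1 + ∣ V H ─ (r ∪ g) ∣`,
  -- against (vi).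
  too-many-vertices : ∀ {φ χ : Fin n → ℕ} (e₁ : Edge k) → InjectiveOn V⁻ χ →
    (∀ {v} → v ∈ᵉ e₁ → Image φ (V H) v) →
    (∀ {w w′ a} → Pair w w′ → a ∈ w → a ≢ z → Image φ (V H) (χ a)) →
    ¬ (∀ {a} → a ∈ V⁻ → ¬ χ a ∈ᵉ e₁)
  too-many-vertices {φ} {χ} e₁ χ-inj e₁⊆ rg⊆ e₁-disjoint = ℕₚ.<⇒≱ few (ℕₚ.∸-monoˡ-≤ 1 k≤)
    where
    S = (r ∪ g) - z

    S⊆V⁻ : S ⊆ V⁻
    S⊆V⁻ a∈ = x∈p∧x≢y⇒x∈p-y
      ([ edge⊆V H r∈E , edge⊆V H g∈E ]′ (x∈p∪q⁻ r g (-∈⇒∈ a∈))) (-∈⇒≢ a∈)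

    xs = Vec.toList (elements e₁) ++ map χ (members S)
    ys = z ∷ members (V H ─ (r ∪ g)) ++ members S

    xs-unique : Unique xs
    xs-unique = Uniqueₚ.++⁺ (increasing-unique (increasing e₁))
      (map-unique (λ a∈ b∈ → χ-inj (S⊆V⁻ (∈-members⁻ S a∈)) (S⊆V⁻ (∈-members⁻ S b∈))) (members-unique S))
      (λ (v∈e₁ , v∈χS) → let a , a∈ , eq = ∈-map⁻ χ v∈χS in
         e₁-disjoint (S⊆V⁻ (∈-members⁻ S a∈)) (subst (_∈ᵉ e₁) eq (∈-toList⁻ v∈e₁)))

    locate : ∀ {v} → Image φ (V H) v → ∃ λ a → a ∈ᴸ ys × φ a ≡ v
    locate (a , a∈V , eq) with a ≟ᶠ z | a ∈? (r ∪ g)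
    ... | yes refl | _       = a , here refl , eq
    ... | no a≢z   | yes a∈  = a , there (∈-++⁺ʳ _ (∈-members⁺ (x∈p∧x≢y⇒x∈p-y a∈ a≢z))) , eq
    ... | no _     | no a∉   = a , there (∈-++⁺ˡ (∈-members⁺ (x∈p∧x∉q⇒x∈p─q a∈V a∉))) , eq

    total : ∀ {v} → v ∈ᴸ xs → ∃ λ a → a ∈ᴸ ys × φ a ≡ v
    total v∈ with ∈-++⁻ (Vec.toList (elements e₁)) v∈
    ... | inj₁ v∈e₁ = locate (e₁⊆ (∈-toList⁻ v∈e₁))
    ... | inj₂ v∈χS with a , a∈ , refl ← ∈-map⁻ χ v∈χS =
      locate ([ (λ a∈r → rg⊆ rg a∈r (-∈⇒≢ a∈S)) , (λ a∈g → rg⊆ gr a∈g (-∈⇒≢ a∈S)) ]′ (x∈p∪q⁻ r g (-∈⇒∈ a∈S)))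
      where a∈S = ∈-members⁻ S a∈

    s = length (members S)
    q = ∣ V H ─ (r ∪ g) ∣

    length-xs : length xs ≡ k + s
    length-xs = trans (length-++ (Vec.toList (elements e₁)))
      (cong₂ _+_ (length-toList (elements e₁)) (length-map χ (members S)))

    length-ys : length ys ≡ suc q + s
    length-ys = cong suc (trans (length-++ (members (V H ─ (r ∪ g)))) (cong (_+ s) (length-members (V H ─ (r ∪ g)))))

    k≤ : k ≤ suc q
    k≤ = ℕₚ.+-cancelʳ-≤ s k (suc q) (subst₂ _≤_ length-xs length-ys
      (length≤length (λ v a → φ a ≡ v) xs-unique total (λ _ _ p p′ → trans (sym p) p′)))


  -- Copies in a list of edges, and images with `z` moved

  NoCopy : List (Edge k) → Set
  NoCopy L = ¬ Copy H (_∈ᴸ L)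

  Embeds : Hypergraph k n → (Fin n → ℕ) → List (Edge k) → Set
  Embeds G ψ L = ∀ {x} → x ∈ᴸ E G → ∃ λ e → e ∈ᴸ L × e ≈ ψ ⟨ x ⟩

  copy-embeds : ∀ {L} (C : Copy H (_∈ᴸ L)) → Embeds H (Copy.φ C) L
  copy-embeds C x∈ = let e , e∈ , p = Copy.maps-E C x∈ in e , e∈ , fromImage e p

  embeds-copy : ∀ {L ψ} → InjectiveOn (V H) ψ → Embeds H ψ L → Copy H (_∈ᴸ L)
  embeds-copy {ψ = ψ} inj emb = record
    { φ = ψ ; injective = inj ; maps-E = λ x∈ → let e , e∈ , p = emb x∈ in e , e∈ , toImage p }

  Disjoint : List (Edge k) → List (Edge k) → Set
  Disjoint L ds = ∀ {e} → e ∈ᴸ L → e ∉ᴸ ds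

  V-inj : ∀ {ψ : Fin n → ℕ} → InjectiveOn (V H) ψ → InjectiveOn V⁻ ψ
  V-inj inj a∈ b∈ = inj (V⁻⊆V a∈) (V⁻⊆V b∈)

  V⁻⁺ : ∀ {a} → a ∈ V H → a ≢ z → a ∈ V⁻
  V⁻⁺ = x∈p∧x≢y⇒x∈p-y

  F⊆V⁻ : ∀ {x} → x ∈ᴸ E F → x ⊆ V⁻
  F⊆V⁻ = edge⊆V F

  module _ {ψ : Fin n → ℕ} (ψ-inj : InjectiveOn (V H) ψ) where

    same-edge : ∀ {x y} {e : Edge k} → x ∈ᴸ E H → y ∈ᴸ E H → e ≈ ψ ⟨ x ⟩ → e ≈ ψ ⟨ y ⟩ → x ≡ y
    same-edge x∈ y∈ = image-injective ψ-inj (edge⊆V H x∈) (edge⊆V H y∈)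

  module _ {φ : Fin n → ℕ} {v : ℕ} where

    extend-image : ∀ {x} {e : Edge k} → z ∉ x → e ≈ φ ⟨ x ⟩ → e ≈ extend φ v ⟨ x ⟩
    extend-image z∉x = image-cong (λ {a} a∈ → sym (extend-≢ {φ} {v} {a} (λ { refl → z∉x a∈ })))

    apex∈ : ∀ {w} {e : Edge k} → z ∈ w → e ≈ extend φ v ⟨ w ⟩ → v ∈ᵉ e
    apex∈ {e = e} z∈w p = subst (_∈ᵉ e) (extend-z φ v) (covers p z∈w)

    apex-only : ∀ {w u} {e : Edge k} → w ⊆ V H → e ≈ extend φ v ⟨ w ⟩ →
      u ∈ᵉ e → ¬ Image φ V⁻ u → u ≡ v
    apex-only w⊆V p u∈ u∉ with a , a∈w , eq ← preimage p u∈ = case a ≟ᶠ z of λ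
      { (yes refl) → trans (sym eq) (extend-z φ v)
      ; (no a≢z)   → contradiction (a , V⁻⁺ (w⊆V a∈w) a≢z , trans (sym (extend-≢ a≢z)) eq) u∉ }

  -- The opponent's graph around a copy of F

  module _ {φ : Fin n → ℕ} (φ-inj : InjectiveOn V⁻ φ) where

    Core : Edge k → Set
    Core e = ∃ λ y → y ∈ᴸ E F × e ≈ φ ⟨ y ⟩

    -- The edges φ(r), φ(g) with z moved to a new vertex, once the other one of them belongs to the
    -- drawing player, whose edges are ds.
    record Dead (ds : List (Edge k)) (e : Edge k) : Set where
      field
        {apex}     : ℕ
        {w w′}     : Subset n
        apex∉      : ¬ Image φ V⁻ apex
        pair       : Pair w w′
        e≈         : e ≈ extend φ apex ⟨ w ⟩
        {partner}  : Edge k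
        partner∈   : partner ∈ᴸ ds
        partner≈   : partner ≈ extend φ apex ⟨ w′ ⟩

    core⊆ : ∀ {e u} → Core e → u ∈ᵉ e → Image φ V⁻ u
    core⊆ (y , y∈ , p) u∈ with a , a∈y , eq ← preimage p u∈ = a , F⊆V⁻ y∈ a∈y , eq

    -- Outside `φ(V⁻)` a dead edge has no vertex but its apex, so both edges have apex `u`. They
    -- come from the same one of `r` and `g`, since otherwise `e′` would be the partner of `e`,
    -- which is in `ds`.
    dead-unique : ∀ {ds e e′ u} → e′ ∉ᴸ ds → Dead ds e → Dead ds e′ →
      u ∈ᵉ e → u ∈ᵉ e′ → ¬ Image φ V⁻ u → e ≡ e′
    dead-unique {e = e} {e′} {u} e′∉ D D′ u∈ u∈′ u∉
      with refl ← apex-only {φ} (edge⊆V H (pair-∈E (Dead.pair D))) (Dead.e≈ D) u∈ u∉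
         | refl ← apex-only {φ} (edge⊆V H (pair-∈E (Dead.pair D′))) (Dead.e≈ D′) u∈′ u∉
      with same-pair (Dead.pair D) (Dead.pair D′)
    ... | inj₁ (refl , _) = image-unique (Dead.e≈ D) (Dead.e≈ D′)
    ... | inj₂ (_ , refl) =
      contradiction (subst (_∈ᴸ _) (image-unique (Dead.partner≈ D) (Dead.e≈ D′)) (Dead.partner∈ D)) e′∉

    -- A vertex outside `φ(V⁻)` lies on at most two edges of `L`, namely `f` and one dead edge,
    -- whereas degrees in `F` are at least 3.
    F-image-inside : ∀ {L ds ψ} f → Disjoint L ds → (∀ {e} → e ∈ᴸ L → e ≡ f ⊎ Core e ⊎ Dead ds e) →
      InjectiveOn V⁻ ψ → Embeds F ψ L → ∀ {a} → a ∈ V⁻ → Image φ V⁻ (ψ a)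
    F-image-inside {L} {ds} {ψ} f L∩ds=∅ classify ψ-inj emb {a} a∈ with image? φ V⁻ (ψ a)
    ... | yes ψa∈ = ψa∈
    ... | no ψa∉ = ⊥-elim (≥3-classes a∈ C class same)
      where
      C : Fin 2 → Subset n → Set
      C zero    x = f ≈ ψ ⟨ x ⟩
      C (suc _) x = ∃ λ e → e ∈ᴸ L × e ≈ ψ ⟨ x ⟩ × Dead ds e

      class : ∀ {x} → x ∈ᴸ E F → a ∈ x → ∃ λ i → C i x
      class x∈ a∈x with e , e∈ , p ← emb x∈ | classify e∈
      ... | inj₁ refl        = zero , p
      ... | inj₂ (inj₁ core) = contradiction (core⊆ core (covers p a∈x)) ψa∉
      ... | inj₂ (inj₂ dead) = suc zero , e , e∈ , p , dead

      same : ∀ i {x y} → x ∈ᴸ E F → y ∈ᴸ E F → a ∈ x → a ∈ y → C i x → C i y → x ≡ y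
      same zero    x∈ y∈ _ _ p q = image-injective ψ-inj (F⊆V⁻ x∈) (F⊆V⁻ y∈) p q
      same (suc _) x∈ y∈ a∈x a∈y (e , e∈ , p , D) (e′ , e′∈ , p′ , D′)
        with refl ← dead-unique (L∩ds=∅ e′∈) D D′ (covers p a∈x) (covers p′ a∈y) ψa∉ =
        image-injective ψ-inj (F⊆V⁻ x∈) (F⊆V⁻ y∈) p p′

    module _ {L ds} (f o : Edge k) (L∩ds=∅ : Disjoint L ds)
             (classify : ∀ {e} → e ∈ᴸ L → e ≡ f ⊎ e ≡ o ⊎ Core e ⊎ Dead ds e)
             (not-both : ∀ {v w w′} → ¬ Image φ V⁻ v → Pair w w′ →
                         f ≈ extend φ v ⟨ w ⟩ → ¬ o ≈ extend φ v ⟨ w′ ⟩) where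

      -- A vertex outside `φ(V⁻)` lies on at most three edges of `L`: `f`, `o` and one dead edge. By
      -- the degree bound 4, `ψ` sends only `z` there. Rigidity then makes the copy equal to `φ`
      -- with `z` moved to `ψ z`. Its edges at `z` can only be `f` and `o`, which `not-both`
      -- excludes.
      no-copy-around-core : NoCopy L
      no-copy-around-core copy = finish (z-class rg) (z-class gr)
        where
        ψ = Copy.φ copy
        ψ-inj : InjectiveOn (V H) ψ
        ψ-inj = Copy.injective copy
        emb = copy-embeds copy

        near : ∀ {a} → a ∈ V H → a ≢ z → Image φ V⁻ (ψ a)
        near {a} a∈ a≢z with image? φ V⁻ (ψ a)
        ... | yes i = i
        ... | no ψa∉ = ⊥-elim (≥4-classes a∈ a≢z C class same)
          where
          C : Fin 3 → Subset n → Set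
          C zero          x = f ≈ ψ ⟨ x ⟩
          C (suc zero)    x = o ≈ ψ ⟨ x ⟩
          C (suc (suc _)) x = ∃ λ e → e ∈ᴸ L × e ≈ ψ ⟨ x ⟩ × Dead ds e

          class : ∀ {x} → x ∈ᴸ E H → a ∈ x → ∃ λ i → C i x
          class x∈ a∈x with e , e∈ , p ← emb x∈ | classify e∈
          ... | inj₁ refl               = zero , p
          ... | inj₂ (inj₁ refl)        = suc zero , p
          ... | inj₂ (inj₂ (inj₁ core)) = contradiction (core⊆ core (covers p a∈x)) ψa∉
          ... | inj₂ (inj₂ (inj₂ dead)) = suc (suc zero) , e , e∈ , p , dead

          same : ∀ i {x y} → x ∈ᴸ E H → y ∈ᴸ E H → a ∈ x → a ∈ y → C i x → C i y → x ≡ y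
          same zero          x∈ y∈ _ _ p q = same-edge ψ-inj x∈ y∈ p q
          same (suc zero)    x∈ y∈ _ _ p q = same-edge ψ-inj x∈ y∈ p q
          same (suc (suc _)) x∈ y∈ a∈x a∈y (e , e∈ , p , D) (e′ , e′∈ , p′ , D′)
            with refl ← dead-unique (L∩ds=∅ e′∈) D D′ (covers p a∈x) (covers p′ a∈y) ψa∉ =
            same-edge ψ-inj x∈ y∈ p p′

        -- Otherwise ψ would embed V H into φ(V⁻), which is smaller.
        ψz∉ : ¬ Image φ V⁻ (ψ z)
        ψz∉ ψz∈ = ℕₚ.1+n≰n (length≤length (λ a b → φ b ≡ ψ a)
            (All.tabulate (λ a∈ → λ { refl → -∈⇒≢ (∈-members⁻ V⁻ a∈) refl }) ∷ members-unique V⁻)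
            total (λ a∈ a′∈ p q → ψ-inj (in-V a∈) (in-V a′∈) (trans (sym p) q)))
          where
          in-V : ∀ {a} → a ∈ᴸ z ∷ members V⁻ → a ∈ V H
          in-V (here refl) = z∈V
          in-V (there a∈)  = V⁻⊆V (∈-members⁻ V⁻ a∈)

          total : ∀ {a} → a ∈ᴸ z ∷ members V⁻ → ∃ λ b → b ∈ᴸ members V⁻ × φ b ≡ ψ a
          total (here refl) = let b , b∈ , eq = ψz∈ in b , ∈-members⁺ b∈ , eq
          total (there a∈)  =
            let a∈V⁻ = ∈-members⁻ V⁻ a∈ ; b , b∈ , eq = near (V⁻⊆V a∈V⁻) (-∈⇒≢ a∈V⁻)
            in b , ∈-members⁺ b∈ , eq

        φ⁺ = extend φ (ψ z)

        dead-apex : ∀ {x e} → x ∈ᴸ E H → e ≈ ψ ⟨ x ⟩ → (D : Dead ds e) → Dead.apex D ≡ ψ z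
        dead-apex x∈ p D
          with a , a∈x , eq ← preimage p (apex∈ {φ} (z∈pair (Dead.pair D)) (Dead.e≈ D)) | a ≟ᶠ z
        ... | yes refl = sym eq
        ... | no a≢z   = contradiction (subst (Image φ V⁻) eq (near (edge⊆V H x∈ a∈x) a≢z)) (Dead.apex∉ D)

        match : ∀ {x} → x ∈ᴸ E H → f ≈ ψ ⟨ x ⟩ ⊎ o ≈ ψ ⟨ x ⟩ ⊎ Matched (V H) φ⁺ ψ x
        match x∈ with e , e∈ , p ← emb x∈ | classify e∈
        ... | inj₁ refl        = inj₁ p
        ... | inj₂ (inj₁ refl) = inj₂ (inj₁ p)
        ... | inj₂ (inj₂ (inj₁ (y , y∈ , q))) =
          let y∈H , z∉y = F⁻ y∈ in inj₂ (inj₂ (y , y∈H , edge⊆V H y∈H , e , p , extend-image z∉y q))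
        ... | inj₂ (inj₂ (inj₂ D)) =
          let w∈ = pair-∈E (Dead.pair D) in
          inj₂ (inj₂ (_ , w∈ , edge⊆V H w∈ , e , p ,
            subst (λ u → e ≈ extend φ u ⟨ _ ⟩) (dead-apex x∈ p D) (Dead.e≈ D)))

        ψ≡φ⁺ : ∀ {a} → a ∈ V H → ψ a ≡ φ⁺ a
        ψ≡φ⁺ {a} a∈ = case a ≟ᶠ z of λ
          { (yes refl) → sym (extend-z φ (ψ z))
          ; (no a≢z)   → rigidity₂ f o id (extend-injective φ-inj ψz∉) ψ-inj match a∈ a≢z }

        image⁺ : ∀ {x} {e : Edge k} → x ∈ᴸ E H → e ≈ ψ ⟨ x ⟩ → e ≈ φ⁺ ⟨ x ⟩
        image⁺ x∈ = image-cong (λ a∈ → ψ≡φ⁺ (edge⊆V H x∈ a∈))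

        z-class : ∀ {w w′} → Pair w w′ → f ≈ ψ ⟨ w ⟩ ⊎ o ≈ ψ ⟨ w ⟩
        z-class P with e , e∈ , p ← emb (pair-∈E P) | classify e∈
        ... | inj₁ refl               = inj₁ p
        ... | inj₂ (inj₁ refl)        = inj₂ p
        ... | inj₂ (inj₂ (inj₁ core)) = contradiction (core⊆ core (covers p (z∈pair P))) ψz∉
        -- The partner of a dead edge would be the other edge at `z` of this copy, but the drawing
        -- player owns it.
        ... | inj₂ (inj₂ (inj₂ D)) =
          let w∈ = pair-∈E (flip-pair (Dead.pair D)) ; e′ , e′∈ , p′ = emb w∈
              q = subst (λ u → _ ≈ extend φ u ⟨ _ ⟩) (dead-apex (pair-∈E P) p D) (Dead.partner≈ D)
          in contradiction (subst (_∈ᴸ ds) (image-unique q (image⁺ w∈ p′)) (Dead.partner∈ D)) (L∩ds=∅ e′∈)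

        finish : f ≈ ψ ⟨ r ⟩ ⊎ o ≈ ψ ⟨ r ⟩ → f ≈ ψ ⟨ g ⟩ ⊎ o ≈ ψ ⟨ g ⟩ → ⊥
        finish (inj₁ p) (inj₁ q) = r≢g (same-edge ψ-inj r∈E g∈E p q)
        finish (inj₁ p) (inj₂ q) = not-both ψz∉ rg (image⁺ r∈E p) (image⁺ g∈E q)
        finish (inj₂ p) (inj₁ q) = not-both ψz∉ gr (image⁺ g∈E q) (image⁺ r∈E p)
        finish (inj₂ p) (inj₂ q) = r≢g (same-edge ψ-inj r∈E g∈E p q)

  -- The opponent's graph around a copy of H without an edge that avoids z

  module _ {φ : Fin n → ℕ} (φ-inj : InjectiveOn (V H) φ) where

    Placed : Edge k → Set
    Placed e = ∃ λ y → y ∈ᴸ E H × e ≈ φ ⟨ y ⟩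

    placed⊆ : ∀ {e u} → Placed e → u ∈ᵉ e → Image φ (V H) u
    placed⊆ (y , y∈ , p) u∈ with a , a∈y , eq ← preimage p u∈ = a , edge⊆V H y∈ a∈y , eq

    -- Only `f` can leave `φ(V H)`, so a vertex outside has degree at most 1 in `L`.
    F-image-inside′ : ∀ {L ψ} f → (∀ {e} → e ∈ᴸ L → e ≡ f ⊎ Placed e) →
      InjectiveOn V⁻ ψ → Embeds F ψ L → ∀ {a} → a ∈ V⁻ → Image φ (V H) (ψ a)
    F-image-inside′ {L} {ψ} f classify ψ-inj emb {a} a∈ with image? φ (V H) (ψ a)
    ... | yes ψa∈ = ψa∈
    ... | no ψa∉ = ⊥-elim (≥3-classes a∈ C class same)
      where
      C : Fin 2 → Subset n → Set
      C zero    x = f ≈ ψ ⟨ x ⟩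
      C (suc _) x = ⊥

      class : ∀ {x} → x ∈ᴸ E F → a ∈ x → ∃ λ i → C i x
      class x∈ a∈x with e , e∈ , p ← emb x∈ | classify e∈
      ... | inj₁ refl   = zero , p
      ... | inj₂ placed = contradiction (placed⊆ placed (covers p a∈x)) ψa∉

      same : ∀ i {x y} → x ∈ᴸ E F → y ∈ᴸ E F → a ∈ x → a ∈ y → C i x → C i y → x ≡ y
      same zero x∈ y∈ _ _ p q = image-injective ψ-inj (F⊆V⁻ x∈) (F⊆V⁻ y∈) p q

    -- Deleting the preimages of `f` and `o` forces `ψ` to agree with `φ` off `z`. As `e₀` avoids
    -- `z`, the copy would need the blocked edge `c`.
    no-copy-around-placed : ∀ {L e₀ c} f o → e₀ ∈ᴸ E H → z ∉ e₀ → c ≈ φ ⟨ e₀ ⟩ → c ∉ᴸ L →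
      (∀ {e} → e ∈ᴸ L → e ≡ f ⊎ e ≡ o ⊎ Placed e) → NoCopy L
    no-copy-around-placed f o e₀∈ z∉e₀ c≈ c∉L classify copy =
      let e , e∈ , p = emb e₀∈
          q = image-cong (λ a∈ → ψ≡φ (edge⊆V H e₀∈ a∈) λ { refl → z∉e₀ a∈ }) p
      in c∉L (subst (_∈ᴸ _) (image-unique q c≈) e∈)
      where
      ψ = Copy.φ copy
      ψ-inj : InjectiveOn (V H) ψ
      ψ-inj = Copy.injective copy
      emb = copy-embeds copy

      match : ∀ {x} → x ∈ᴸ E H → f ≈ ψ ⟨ x ⟩ ⊎ o ≈ ψ ⟨ x ⟩ ⊎ Matched (V H) φ ψ x
      match x∈ with e , e∈ , p ← emb x∈ | classify e∈
      ... | inj₁ refl                   = inj₁ p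
      ... | inj₂ (inj₁ refl)            = inj₂ (inj₁ p)
      ... | inj₂ (inj₂ (y , y∈ , q))    = inj₂ (inj₂ (y , y∈ , edge⊆V H y∈ , e , p , q))

      ψ≡φ : ∀ {a} → a ∈ V H → a ≢ z → ψ a ≡ φ a
      ψ≡φ = rigidity₂ f o id φ-inj ψ-inj match

  -- Threats at fresh vertices and their answers

  Same : (Fin n → ℕ) → Subset n → (Fin n → ℕ) → Subset n → Set
  Same ψ w χ c = Image ψ (w - z) ≐ Image χ (c - z)

  -z⊆V⁻ : ∀ {w w′} → Pair w w′ → w - z ⊆ V⁻
  -z⊆V⁻ P a∈ = V⁻⁺ (edge⊆V H (pair-∈E P) (-∈⇒∈ a∈)) (-∈⇒≢ a∈)

  module _ {χ ψ : Fin n → ℕ} {v : ℕ} (ψ-inj : InjectiveOn (V H) ψ) (v∉ : ¬ Image χ V⁻ v) (ψz≡v : ψ z ≡ v) where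

    -- Once both maps send `z` to `v`, only the other vertices of the edge matter, and `Same`
    -- compares these. This frees `Harmless` from the apex of a particular threat.
    restrict : ∀ {w w′ c c′} {e : Edge k} → Pair w w′ → Pair c c′ →
      e ≈ ψ ⟨ w ⟩ → e ≈ extend χ v ⟨ c ⟩ → Same ψ w χ c
    restrict {w} {c = c} {e = e} P Q p q = onto , back
      where
      onto : ∀ {u} → Image ψ (w - z) u → Image χ (c - z) u
      onto (a , a∈ , refl) with b , b∈c , eq ← preimage q (covers p (-∈⇒∈ a∈)) = case b ≟ᶠ z of λ
        { (yes refl) → contradiction
            (ψ-inj (V⁻⊆V (-z⊆V⁻ P a∈)) z∈V (trans (sym eq) (trans (extend-z χ v) (sym ψz≡v)))) (-∈⇒≢ a∈)
        ; (no b≢z)   → b , x∈p∧x≢y⇒x∈p-y b∈c b≢z , trans (sym (extend-≢ b≢z)) eq }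

      back : ∀ {u} → Image χ (c - z) u → Image ψ (w - z) u
      back (b , b∈ , refl)
        with a , a∈w , eq ← preimage p (subst (_∈ᵉ e) (extend-≢ {χ} {v} (-∈⇒≢ b∈)) (covers q (-∈⇒∈ b∈))) =
        case a ≟ᶠ z of λ
          { (yes refl) → contradiction (b , -z⊆V⁻ Q b∈ , trans (sym eq) ψz≡v) v∉
          ; (no a≢z)   → a , x∈p∧x≢y⇒x∈p-y a∈w a≢z , eq }

    unrestrict : ∀ {w w′ c c′} {e : Edge k} → Pair w w′ → Pair c c′ →
      Same ψ w χ c → e ≈ ψ ⟨ w ⟩ → e ≈ extend χ v ⟨ c ⟩
    unrestrict {w} {c = c} {e = e} P Q (to , from) p = isImage onto back
      where
      onto : ∀ {u} → u ∈ᵉ e → Image (extend χ v) c u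
      onto u∈ with a , a∈w , eq ← preimage p u∈ = case a ≟ᶠ z of λ
        { (yes refl) → z , z∈pair Q , trans (extend-z χ v) (trans (sym ψz≡v) eq)
        ; (no a≢z)   → let b , b∈ , eq′ = to (a , x∈p∧x≢y⇒x∈p-y a∈w a≢z , eq)
                       in b , -∈⇒∈ b∈ , trans (extend-≢ (-∈⇒≢ b∈)) eq′ }

      back : ∀ {b} → b ∈ c → extend χ v b ∈ᵉ e
      back {b} b∈c = case b ≟ᶠ z of λ
        { (yes refl) → subst (_∈ᵉ e) (trans ψz≡v (sym (extend-z χ v))) (covers p (z∈pair P))
        ; (no b≢z)   → let a , a∈ , eq = from (b , x∈p∧x≢y⇒x∈p-y b∈c b≢z , refl)
                       in subst (_∈ᵉ e) (trans eq (sym (extend-≢ b≢z))) (covers p (-∈⇒∈ a∈)) }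

  module _ {χ : Fin n → ℕ} (χ-inj : InjectiveOn V⁻ χ) {c₁ c₂ : Subset n} (C : Pair c₁ c₂) where

    -- `X` is the opponent's graph before the first threat. Freshness with respect to `X` is enough,
    -- as two answers with the same apex are the same edge.
    record Answer (X ds : List (Edge k)) (e : Edge k) : Set where
      field
        {apex}   : ℕ
        fresh    : ∀ {e′} → e′ ∈ᴸ X → ¬ apex ∈ᵉ e′
        apex∉    : ¬ Image χ V⁻ apex
        answer≈  : e ≈ extend χ apex ⟨ c₂ ⟩
        {threat} : Edge k
        threat∈  : threat ∈ᴸ ds
        threat≈  : threat ≈ extend χ apex ⟨ c₁ ⟩

    -- If an answer is the image of r or g for a copy of F in X, then the edge that is missing from a copy of
    -- H is the threat that forced the answer, hence already taken.
    Harmless : List (Edge k) → Set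
    Harmless X = ∀ {ψ} → InjectiveOn V⁻ ψ → Embeds F ψ X →
      ∀ {w w′} → Pair w w′ → Same ψ w χ c₂ → ¬ ¬ Same ψ w′ χ c₁

    -- The apex of an answer lies on no edge of `L` but that answer and perhaps `o`. So in a copy it
    -- is the image of `z`, and the answer and `o` are the images of `r` and `g` in some order. The
    -- rest is a copy of `F` in `X`, and `Harmless` identifies `o` with the threat, which the
    -- drawing player owns.
    no-copy-after-answers : ∀ {X ds L} o → Disjoint L ds →
      (∀ {e} → e ∈ᴸ L → e ≡ o ⊎ e ∈ᴸ X ⊎ Answer X ds e) →
      NoCopy (o ∷ X) → Harmless X → NoCopy L
    no-copy-after-answers {X} {ds} {L} o L∩ds=∅ classify no-threat harmless copy = conclude (all⊎exists split)
      where
      ψ = Copy.φ copy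
      ψ-inj : InjectiveOn (V H) ψ
      ψ-inj = Copy.injective copy
      emb = copy-embeds copy

      Answered : Subset n → Set
      Answered x = ∃ λ e → e ∈ᴸ L × e ≈ ψ ⟨ x ⟩ × Answer X ds e

      split : ∀ {x} → x ∈ᴸ E H → Answered x ⊎ (∃ λ e → e ∈ᴸ o ∷ X × e ≈ ψ ⟨ x ⟩)
      split x∈ with e , e∈ , p ← emb x∈ | classify e∈
      ... | inj₁ e≡o        = inj₂ (e , here e≡o , p)
      ... | inj₂ (inj₁ e∈X) = inj₂ (e , there e∈X , p)
      ... | inj₂ (inj₂ A)   = inj₁ (e , e∈ , p , A)

      apex-unique : ∀ {e u} → (A : Answer X ds e) → ¬ Image χ V⁻ u → u ∈ᵉ e → u ≡ Answer.apex A
      apex-unique A u∉ u∈ = apex-only {χ} (edge⊆V H (pair-∈E (flip-pair C))) (Answer.answer≈ A) u∈ u∉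

      meets-answer : ∀ {e e′} (A : Answer X ds e) → e′ ∈ᴸ L → Answer.apex A ∈ᵉ e′ → e′ ≡ e ⊎ e′ ≡ o
      meets-answer A e′∈ v∈ with classify e′∈
      ... | inj₁ e′≡o       = inj₂ e′≡o
      ... | inj₂ (inj₁ ∈X)  = contradiction v∈ (Answer.fresh A ∈X)
      ... | inj₂ (inj₂ A′) with refl ← apex-unique A′ (Answer.apex∉ A) v∈ =
        inj₁ (image-unique (Answer.answer≈ A′) (Answer.answer≈ A))

      apex-at-z : ∀ {x e} → x ∈ᴸ E H → e ≈ ψ ⟨ x ⟩ → (A : Answer X ds e) → z ∈ x × ψ z ≡ Answer.apex A
      apex-at-z {x} {e} x∈ p A
        with a , a∈x , eq ← preimage p (apex∈ {χ} (z∈pair (flip-pair C)) (Answer.answer≈ A)) = case a ≟ᶠ z of λ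
          { (yes refl) → a∈x , eq
          ; (no a≢z)   → ⊥-elim (≥4-classes (edge⊆V H x∈ a∈x) a≢z D
                           (λ y∈ a∈y → class y∈ (λ {e′} q → subst (_∈ᵉ e′) eq (covers q a∈y)))
                           (λ i x∈ y∈ _ _ → same i x∈ y∈)) }
        where
        D : Fin 3 → Subset n → Set
        D zero          y = e ≈ ψ ⟨ y ⟩
        D (suc zero)    y = o ≈ ψ ⟨ y ⟩
        D (suc (suc _)) y = ⊥

        class : ∀ {y} → y ∈ᴸ E H → (∀ {e′} → e′ ≈ ψ ⟨ y ⟩ → Answer.apex A ∈ᵉ e′) → ∃ λ i → D i y
        class y∈ v∈ with e′ , e′∈ , q ← emb y∈ | meets-answer A e′∈ (v∈ q)
        ... | inj₁ refl = zero , q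
        ... | inj₂ refl = suc zero , q

        same : ∀ i {y y′} → y ∈ᴸ E H → y′ ∈ᴸ E H → D i y → D i y′ → y ≡ y′
        same zero       y∈ y′∈ p q = same-edge ψ-inj y∈ y′∈ p q
        same (suc zero) y∈ y′∈ p q = same-edge ψ-inj y∈ y′∈ p q

      conclude : ¬ ((∀ {x} → x ∈ᴸ E H → ∃ λ e → e ∈ᴸ o ∷ X × e ≈ ψ ⟨ x ⟩) ⊎ (∃ λ x → x ∈ᴸ E H × Answered x))
      conclude (inj₁ all) = no-threat (embeds-copy ψ-inj all)
      conclude (inj₂ (w , w∈ , e , e∈ , p , A))
        with z∈w , ψz≡v ← apex-at-z w∈ p A
        with w′ , P ← z-edge w∈ z∈w
        with e′ , e′∈ , p′ ← emb (pair-∈E (flip-pair P))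
        with meets-answer A e′∈ (subst (_∈ᵉ e′) ψz≡v (covers p′ (z∈pair (flip-pair P))))
      ... | inj₁ refl = pair-≢ P (same-edge ψ-inj w∈ (pair-∈E (flip-pair P)) p p′)
      ... | inj₂ refl = harmless (V-inj ψ-inj) F-in-X P
            (restrict ψ-inj (Answer.apex∉ A) ψz≡v P (flip-pair C) p (Answer.answer≈ A))
            (λ same → L∩ds=∅ e′∈ (subst (_∈ᴸ ds)
              (image-unique (Answer.threat≈ A)
                (unrestrict ψ-inj (Answer.apex∉ A) ψz≡v (flip-pair P) C same p′))
              (Answer.threat∈ A)))
        where
        F-in-X : Embeds F ψ X
        F-in-X y∈ with y∈H , z∉y ← F⁻ y∈ with e″ , e″∈ , q ← emb y∈H | classify e″∈
        ... | inj₁ refl       = contradiction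
          (subst (z ∈_) (same-edge ψ-inj (pair-∈E (flip-pair P)) y∈H p′ q) (z∈pair (flip-pair P))) z∉y
        ... | inj₂ (inj₁ ∈X)  = e″ , ∈X , q
        ... | inj₂ (inj₂ A′)  = contradiction (proj₁ (apex-at-z y∈H q A′)) z∉y

    -- Every answer contains `χ a`, while copies of `F` in `X` stay inside `φ(V H)`; hence the
    -- premise `Same ψ w χ c₂` never holds.
    harmless-outside : ∀ {φ : Fin n → ℕ} {X a} → a ∈ c₂ → a ≢ z → ¬ Image φ (V H) (χ a) →
      (∀ {ψ} → InjectiveOn V⁻ ψ → Embeds F ψ X → ∀ {b} → b ∈ V⁻ → Image φ (V H) (ψ b)) → Harmless X
    harmless-outside a∈ a≢z χa∉ F-inside ψ-inj emb P (_ , from) =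
      let b , b∈ , eq = from (_ , x∈p∧x≢y⇒x∈p-y a∈ a≢z , refl)
      in contradiction (subst (Image _ (V H)) eq (F-inside ψ-inj emb (-z⊆V⁻ P b∈))) χa∉

  -- No threat at the end of the opening: the order of `r` and `g`

  module _ {χ : Fin n → ℕ} (χ-inj : InjectiveOn V⁻ χ) {X T : List (Edge k)} {e₁ : Edge k}
           (X⊆ : ∀ {e} → e ∈ᴸ X → e ≡ e₁ ⊎ e ∈ᴸ T) (T-small : length T ≤ length (E F))
           (e₁-disjoint : ∀ {a} → a ∈ V⁻ → ¬ χ a ∈ᵉ e₁) where

    -- By (v) each edge of `F` meets `w`, necessarily away from `z`. Its image therefore meets
    -- `χ(c - z)`, which is disjoint from `e₁`.
    avoids-e₁ : ∀ {ψ w w′ c c′} → Embeds F ψ X → Pair w w′ → Pair c c′ → Same ψ w χ c → Embeds F ψ T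
    avoids-e₁ {ψ} {w} emb P Q (to , _) {x} x∈ with e , e∈ , p ← emb x∈ | X⊆ e∈
    ... | inj₂ e∈T  = e , e∈T , p
    ... | inj₁ refl =
      let x∈H , z∉x = F⁻ x∈
          a , a∈x , a∈w = meet P x∈H
          b , b∈ , eq = to (a , x∈p∧x≢y⇒x∈p-y a∈w (λ a≡z → z∉x (subst (_∈ x) a≡z a∈x)) , refl)
      in contradiction (subst (_∈ᵉ e₁) (sym eq) (covers p a∈x)) (e₁-disjoint (-z⊆V⁻ Q b∈))
      where
      meet : ∀ {w w′} → Pair w w′ → x ∈ᴸ E H → ∃ λ a → a ∈ x × a ∈ w
      meet rg x∈H = let a , a∈ = proj₁ (meets x x∈H) in a , x∈p∩q⁻ x r a∈
      meet gr x∈H = let a , a∈ = proj₂ (meets x x∈H) in a , x∈p∩q⁻ x g a∈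

    -- `T` has no more edges than `F`, so both embeddings use all of it, and rigidity applies with
    -- `r` and `g` deleted.
    agree : ∀ {ψ₁ ψ₂} → InjectiveOn V⁻ ψ₁ → InjectiveOn V⁻ ψ₂ → Embeds F ψ₁ T → Embeds F ψ₂ T →
      ∀ {a} → a ∈ V⁻ → ψ₁ a ≡ ψ₂ a
    agree {ψ₁} {ψ₂} inj₁′ inj₂′ emb₁ emb₂ a∈ =
      rigidity V⁻⊆V inj₂′ inj₁′ r∈E g∈E r≢g match (V⁻⊆V a∈) (-∈⇒≢ a∈)
      where
      match : ∀ {x} → x ∈ᴸ E H → x ≢ r → x ≢ g → x ⊆ V⁻ × Matched V⁻ ψ₂ ψ₁ x
      match {x} x∈ x≢r x≢g with z ∈? x
      ... | yes z∈x = case z-edge x∈ z∈x of λ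
              { (_ , rg) → contradiction refl x≢r ; (_ , gr) → contradiction refl x≢g }
      ... | no z∉x =
        let x∈F = F⁺ x∈ z∉x
            e , e∈ , p = emb₁ x∈F
            y , y∈ , q = embedding-onto F inj₂′ emb₂ T-small e∈
        in F⊆V⁻ x∈F , y , proj₁ (F⁻ y∈) , F⊆V⁻ y∈ , e , p , q

    -- The two embeddings are the same map on `V⁻`. Then `w` and `u` differ because `c₁` and `c₂`
    -- do, so `u` is `w′`, and what is known of `ψ₂` is the conclusion for `ψ₁`.
    both-orders : ∀ {ψ₁ ψ₂ w w′ u u′ c₁ c₂} → Pair c₁ c₂ →
      InjectiveOn V⁻ ψ₁ → Embeds F ψ₁ X → Pair w w′ → Same ψ₁ w χ c₂ →
      InjectiveOn V⁻ ψ₂ → Embeds F ψ₂ X → Pair u u′ → Same ψ₂ u χ c₁ → Same ψ₁ w′ χ c₁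
    both-orders {ψ₁} {ψ₂} {u = u} {c₁ = c₁} {c₂} C ψ₁-inj emb₁ P same₁ ψ₂-inj emb₂ Q same₂
      with same-pair P Q
    ... | inj₂ (_ , refl) = transfer
      where
      ψ≡ : ∀ {a} → a ∈ V⁻ → ψ₁ a ≡ ψ₂ a
      ψ≡ = agree ψ₁-inj ψ₂-inj (avoids-e₁ emb₁ P (flip-pair C) same₁) (avoids-e₁ emb₂ Q C same₂)
      transfer : Same ψ₁ u χ c₁
      transfer = (λ (a , a∈ , eq) → proj₁ same₂ (a , a∈ , trans (sym (ψ≡ (-z⊆V⁻ Q a∈))) eq)) ,
                 (λ v∈ → let a , a∈ , eq = proj₂ same₂ v∈ in a , a∈ , trans (ψ≡ (-z⊆V⁻ Q a∈)) eq)
    ... | inj₁ (refl , _) = contradiction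
        (⊆-antisym (sub C (λ v∈ → to₁ (from₂ v∈))) (sub (flip-pair C) (λ v∈ → to₂ (from₁ v∈)))) (pair-≢ C)
      where
      ψ≡ : ∀ {a} → a ∈ V⁻ → ψ₁ a ≡ ψ₂ a
      ψ≡ = agree ψ₁-inj ψ₂-inj (avoids-e₁ emb₁ P (flip-pair C) same₁) (avoids-e₁ emb₂ Q C same₂)

      to₁ : ∀ {v} → Image ψ₁ (u - z) v → Image χ (c₂ - z) v
      to₁ = proj₁ same₁

      from₁ : ∀ {v} → Image χ (c₂ - z) v → Image ψ₂ (u - z) v
      from₁ v∈ = let a , a∈ , eq = proj₂ same₁ v∈ in a , a∈ , trans (sym (ψ≡ (-z⊆V⁻ Q a∈))) eq

      to₂ : ∀ {v} → Image ψ₂ (u - z) v → Image χ (c₁ - z) v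
      to₂ = proj₁ same₂

      from₂ : ∀ {v} → Image χ (c₁ - z) v → Image ψ₁ (u - z) v
      from₂ v∈ = let a , a∈ , eq = proj₂ same₂ v∈ in a , a∈ , trans (ψ≡ (-z⊆V⁻ Q a∈)) eq

      sub : ∀ {d d′} → Pair d d′ → (∀ {v} → Image χ (d - z) v → Image χ (d′ - z) v) → d ⊆ d′
      sub D f {a} a∈ = case a ≟ᶠ z of λ
        { (yes refl) → z∈pair (flip-pair D)
        ; (no a≢z)   →
            let b , b∈ , eq = f (a , x∈p∧x≢y⇒x∈p-y a∈ a≢z , refl)
            in subst (_∈ _) (χ-inj (-z⊆V⁻ (flip-pair D) b∈) (-z⊆V⁻ D (x∈p∧x≢y⇒x∈p-y a∈ a≢z)) eq) (-∈⇒∈ b∈) }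

    -- `Harmless` ranges over all embeddings, so the order is not computed. A failure `ψ₁` of the
    -- first order leaves no `ψ₂` at which the second could fail.
    some-order-harmless : ¬ ¬ (Harmless χ-inj rg X ⊎ Harmless χ-inj gr X)
    some-order-harmless neither = neither (inj₁ λ ψ₁-inj emb₁ P same₁ ¬same →
      neither (inj₂ λ ψ₂-inj emb₂ Q same₂ _ →
        ¬same (both-orders rg ψ₁-inj emb₁ P same₁ ψ₂-inj emb₂ Q same₂)))

  -- Fresh vertices and unclaimed edges of the board

  supremum : ∀ {m} → Vec ℕ m → ℕ
  supremum []       = 0
  supremum (x ∷ xs) = suc x ⊔ supremum xs

  ∈⇒<supremum : ∀ {m v} {xs : Vec ℕ m} → v ∈ⱽ xs → v < supremum xs
  ∈⇒<supremum {xs = x ∷ xs} (hereⱽ refl) = ℕₚ.m≤m⊔n (suc x) (supremum xs)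
  ∈⇒<supremum {xs = x ∷ _}  (thereⱽ v∈) = ≤-trans (∈⇒<supremum v∈) (ℕₚ.m≤n⊔m (suc x) _)

  above : List (Edge k) → ℕ
  above []      = 0
  above (e ∷ L) = supremum (elements e) ⊔ above L

  ∈⇒<above : ∀ {L e v} → e ∈ᴸ L → v ∈ᵉ e → v < above L
  ∈⇒<above (here refl) v∈ = ≤-trans (∈⇒<supremum v∈) (ℕₚ.m≤m⊔n _ _)
  ∈⇒<above {d ∷ _} (there e∈) v∈ = ≤-trans (∈⇒<above e∈ v∈) (ℕₚ.m≤n⊔m (supremum (elements d)) _)

  above∉ : ∀ {L e} → e ∈ᴸ L → ¬ above L ∈ᵉ e
  above∉ e∈ v∈ = <-irrefl refl (∈⇒<above e∈ v∈)

  interval : (v : ℕ) → ∃ λ (e : Edge k) → e ≈ (λ (a : Fin k) → v + toℕ a) ⟨ full ⟩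
  interval v = image _ full (∣⊤∣≡n k) λ _ _ eq → toℕ-injective (ℕₚ.+-cancelˡ-≡ v _ _ eq)

  ∈-interval : ∀ v → v ∈ᵉ proj₁ (interval v)
  ∈-interval v = base 2≤k (proj₂ (interval v))
    where
    base : ∀ {j} {e : Edge k} → 2 ≤ j → e ≈ (λ (a : Fin j) → v + toℕ a) ⟨ full ⟩ → v ∈ᵉ e
    base {e = e} (s≤s _) p = subst (_∈ᵉ e) (ℕₚ.+-identityʳ v) (covers p {zero} ∈⊤)

  unclaimed : (L : List (Edge k)) → ∃ λ e → e ∉ᴸ L
  unclaimed L = proj₁ (interval (above L)) , λ e∈ → above∉ e∈ (∈-interval (above L))

  edge-image : ∀ {φ x} → InjectiveOn (V H) φ → x ∈ᴸ E H → ∃ λ (e : Edge k) → e ≈ φ ⟨ x ⟩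
  edge-image {φ} {x} φ-inj x∈ = image φ x (edge-size H x∈) (λ a∈ b∈ → φ-inj (edge⊆V H x∈ a∈) (edge⊆V H x∈ b∈))

  -- ds lists the moves of the drawing player, latest first; ω ds is the opponent's edge that follows them.
  module Game (ω : List (Edge k) → Edge k) (ω-legal : ∀ ds → ω ds ∉ᴸ ds) where

    replies : List (Edge k) → List (Edge k)
    replies []       = []
    replies (d ∷ ds) = ω (d ∷ ds) ∷ replies ds

    os : List (Edge k) → List (Edge k)
    os []       = ω [] ∷ []
    os (d ∷ ds) = ω (d ∷ ds) ∷ os ds

    os⁻ : ∀ ds {e} → e ∈ᴸ os ds → e ≡ ω [] ⊎ e ∈ᴸ replies ds
    os⁻ []       (here eq)   = inj₁ eq
    os⁻ (d ∷ ds) (here eq)   = inj₂ (here eq)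
    os⁻ (d ∷ ds) (there e∈)  = [ inj₁ , inj₂ ∘ there ]′ (os⁻ ds e∈)

    ω∈os : ∀ ds → ω ds ∈ᴸ os ds
    ω∈os []       = here refl
    ω∈os (_ ∷ _)  = here refl

    ω[]∈os : ∀ ds → ω [] ∈ᴸ os ds
    ω[]∈os []       = here refl
    ω[]∈os (_ ∷ ds) = there (ω[]∈os ds)

    length-os : ∀ ds → length (os ds) ≡ suc (length ds)
    length-os []       = refl
    length-os (_ ∷ ds) = cong suc (length-os ds)

    length-replies : ∀ ds → length (replies ds) ≡ length ds
    length-replies []       = refl
    length-replies (_ ∷ ds) = cong suc (length-replies ds)

    -- The opponent holds at most one edge more than `F` has; `H` has at least two more.
    no-copy-yet : ∀ ds → length ds ≤ length (E F) → ∀ {ψ} → InjectiveOn (V H) ψ → ¬ Embeds H ψ (os ds)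
    no-copy-yet ds ≤F inj emb = ℕₚ.1+n≰n
      (≤-trans (≤-trans (s≤s (s≤s ≤F)) size-F)
        (subst (length (E H) ≤_) (length-os ds) (embedding-size H inj emb)))

    Legal-position : List (Edge k) → Set
    Legal-position ds = Disjoint (os ds) ds

    legal-move : ∀ {d ds} → Legal-position ds → d ∉ᴸ os ds → Legal-position (d ∷ ds)
    legal-move {d} {ds} L d∉ (here refl) e∈          = ω-legal (d ∷ ds) e∈
    legal-move L d∉ (there e∈) (here refl)  = d∉ e∈
    legal-move L d∉ (there e∈) (there e∈ds) = L e∈ e∈ds

    -- The endgame: states, moves and safety

    module Endgame {χ : Fin n → ℕ} (χ-inj : InjectiveOn V⁻ χ) where

      -- `X` is frozen when the first threat is made. `no-threat` concerns every `o` outside `ds`,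
      -- because a reply other than the answer can be any such edge.
      record Threatening (ds : List (Edge k)) : Set where
        field
          {c₁ c₂}   : Subset n
          C         : Pair c₁ c₂
          own       : Embeds F χ ds
          X         : List (Edge k)
          X⊆        : ∀ {e} → e ∈ᴸ X → e ∈ᴸ os ds
          classify  : ∀ {e} → e ∈ᴸ os ds → e ∈ᴸ X ⊎ Answer χ-inj C X ds e
          no-threat : ∀ o → o ∉ᴸ ds → NoCopy (o ∷ X)
          harmless  : Harmless χ-inj C X

      record Finishing (ds : List (Edge k)) : Set where
        field
          no-copy : NoCopy (os ds)
          last    : Edge k
          last∉ds : last ∉ᴸ ds
          last∉os : last ∉ᴸ os ds
          copy    : Copy H (_∈ᴸ last ∷ ds)

      -- The opponent's last edge may be a threat around φ(F); his older ones no longer are.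
      record Chasing (ds : List (Edge k)) : Set where
        field
          own      : Embeds F χ ds
          {φ}      : Fin n → ℕ
          φ-inj    : InjectiveOn (V H) φ
          {c₁ c₂}  : Subset n
          C        : Pair c₁ c₂
          {a}      : Fin n
          a∈       : a ∈ c₂
          a≢z      : a ≢ z
          χa∉      : ¬ Image φ (V H) (χ a)
          classify : ∀ {e} → e ∈ᴸ os ds → e ≡ ω ds ⊎ Core (V-inj φ-inj) e ⊎ Dead (V-inj φ-inj) ds e

      -- The vertex `a` already settles which edge will be the answer later: it is one of `c₂` that
      -- `χ` sends outside `φ(V H)`.
      record Blocking (ds : List (Edge k)) : Set where
        field
          own      : Embeds F χ ds
          no-copy  : NoCopy (os ds)
          {φ}      : Fin n → ℕ
          φ-inj    : InjectiveOn (V H) φ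
          {c₁ c₂}  : Subset n
          C        : Pair c₁ c₂
          {a}      : Fin n
          a∈       : a ∈ c₂
          a≢z      : a ≢ z
          χa∉      : ¬ Image φ (V H) (χ a)
          {e₀}     : Subset n
          e₀∈      : e₀ ∈ᴸ E H
          {block}  : Edge k
          block≈   : block ≈ φ ⟨ e₀ ⟩
          block∉ds : block ∉ᴸ ds
          block∉os : block ∉ᴸ os ds
          classify : ∀ {e} → e ∈ᴸ os ds → ∃ λ y → y ∈ᴸ E H × y ≢ e₀ × e ≈ φ ⟨ y ⟩

      -- Once it is known, up to double negation, in which state the endgame starts, all further moves and
      -- states are computed from the opponent's edges.
      data State (ds : List (Edge k)) : Set where
        threatening : Threatening ds → State ds
        finishing   : Finishing ds → State ds
        chasing     : Chasing ds → State ds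
        blocking    : Blocking ds → State ds
        won         : Copy H (_∈ᴸ ds) → State ds

      Next : List (Edge k) → Set
      Next ds = ∃ λ d → d ∉ᴸ ds × d ∉ᴸ os ds × State (d ∷ ds)

      own-∷ : ∀ {d ds} → Embeds F χ ds → Embeds F χ (d ∷ ds)
      own-∷ own x∈ = let e , e∈ , p = own x∈ in e , there e∈ , p

      threatening-no-copy : ∀ {ds} → Legal-position ds → Threatening ds → NoCopy (os ds)
      threatening-no-copy {ds} legal T = no-copy-after-answers χ-inj C (ω ds) legal
          (inj₂ ∘ classify) (no-threat (ω ds) (legal (ω∈os ds))) harmless
        where open Threatening T

      threaten : ∀ {ds} → Legal-position ds → Threatening ds → Next ds
      threaten {ds} legal T = threat , threat∉ds , threat∉os , next (ω (threat ∷ ds) ≟ᵉ answer)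
        where
        open Threatening T
        v = above (ds ++ os ds)

        v∉ds : ∀ {e} → e ∈ᴸ ds → ¬ v ∈ᵉ e
        v∉ds e∈ = above∉ (∈-++⁺ˡ e∈)

        v∉os : ∀ {e} → e ∈ᴸ os ds → ¬ v ∈ᵉ e
        v∉os e∈ = above∉ (∈-++⁺ʳ ds e∈)

        -- Each vertex of `χ(V⁻)` lies on an edge of `χ(F)`, and these edges are in `ds`.
        v∉χ : ¬ Image χ V⁻ v
        v∉χ (a , a∈ , eq) =
          let x , x∈ , a∈x = F-covers a∈ ; e , e∈ , p = own x∈
          in v∉ds e∈ (subst (_∈ᵉ e) eq (covers p a∈x))

        χ⁺-inj : InjectiveOn (V H) (extend χ v)
        χ⁺-inj = extend-injective χ-inj v∉χ

        threat-image = edge-image χ⁺-inj (pair-∈E C)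
        threat = proj₁ threat-image
        answer-image = edge-image χ⁺-inj (pair-∈E (flip-pair C))
        answer = proj₁ answer-image

        v∈threat : v ∈ᵉ threat
        v∈threat = apex∈ {χ} (z∈pair C) (proj₂ threat-image)

        v∈answer : v ∈ᵉ answer
        v∈answer = apex∈ {χ} (z∈pair (flip-pair C)) (proj₂ answer-image)

        threat∉ds : threat ∉ᴸ ds
        threat∉ds e∈ = v∉ds e∈ v∈threat

        threat∉os : threat ∉ᴸ os ds
        threat∉os e∈ = v∉os e∈ v∈threat

        ds⁺ = threat ∷ ds

        older : ∀ {e} → Answer χ-inj C X ds e → Answer χ-inj C X ds⁺ e
        older A = record
          { fresh = Answer.fresh A ; apex∉ = Answer.apex∉ A ; answer≈ = Answer.answer≈ A
          ; threat∈ = there (Answer.threat∈ A) ; threat≈ = Answer.threat≈ A }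

        newest : Answer χ-inj C X ds⁺ answer
        newest = record
          { fresh = v∉os ∘ X⊆ ; apex∉ = v∉χ ; answer≈ = proj₂ answer-image
          ; threat∈ = here refl ; threat≈ = proj₂ threat-image }

        completed : Copy H (_∈ᴸ answer ∷ ds⁺)
        completed = embeds-copy χ⁺-inj emb
          where
          emb : Embeds H (extend χ v) (answer ∷ ds⁺)
          emb {x} x∈ with z ∈? x
          ... | no z∉x = let e , e∈ , p = own (F⁺ x∈ z∉x) in e , there (there e∈) , extend-image z∉x p
          ... | yes z∈x with _ , P ← z-edge x∈ z∈x with same-pair P C
          ... | inj₁ (refl , _) = threat , there (here refl) , proj₂ threat-image
          ... | inj₂ (refl , _) = answer , here refl , proj₂ answer-image

        next : Dec (ω ds⁺ ≡ answer) → State ds⁺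
        next (yes eq) = threatening record
          { C = C ; own = own-∷ own ; X = X ; X⊆ = there ∘ X⊆
          ; classify = λ { (here refl) → inj₂ (subst (Answer χ-inj C X ds⁺) (sym eq) newest)
                         ; (there e∈) → [ inj₁ , inj₂ ∘ older ]′ (classify e∈) }
          ; no-threat = λ o o∉ → no-threat o (o∉ ∘ there)
          ; harmless = harmless }
        -- The reply plays the part of `o`; the unanswered threat is carried out on the next move.
        next (no ≢answer) = finishing record
          { no-copy = no-copy-after-answers χ-inj C (ω ds⁺) (legal-move legal threat∉os)
              (λ { (here refl) → inj₁ refl ; (there e∈) → inj₂ ([ inj₁ , inj₂ ∘ older ]′ (classify e∈)) })
              (no-threat (ω ds⁺) (ω-legal ds⁺ ∘ there)) harmless
          ; last = answer
          ; last∉ds = λ { (here eq) → pair-≢ (flip-pair C)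
                            (same-edge χ⁺-inj (pair-∈E (flip-pair C)) (pair-∈E C) (proj₂ answer-image)
                              (subst (_≈ extend χ v ⟨ _ ⟩) (sym eq) (proj₂ threat-image)))
                        ; (there e∈) → v∉ds e∈ v∈answer }
          ; last∉os = λ { (here eq) → ≢answer (sym eq) ; (there e∈) → v∉os e∈ v∈answer }
          ; copy = completed }

      module _ {ds : List (Edge k)} (legal : Legal-position ds) (S : Chasing ds) where
        open Chasing S

        private
          f = ω ds
          φ⁻-inj : InjectiveOn V⁻ φ
          φ⁻-inj = V-inj φ-inj

          -- The only way in which `f` can threaten a copy with `z` at `v`: the complementary edge
          -- is not yet in `ds`.
          Live : Subset n → Subset n → ℕ → Set
          Live w w′ v = ¬ Image φ V⁻ v × f ≈ extend φ v ⟨ w ⟩ × ¬ Any (_≈ extend φ v ⟨ w′ ⟩) ds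

          live? : ∀ w w′ v → Dec (Live w w′ v)
          live? w w′ v = ¬? (image? φ V⁻ v) ×-dec
            (isImage? f (extend φ v) w ×-dec ¬? (Any.any? (λ e → isImage? e (extend φ v) w′) ds))

          distinct-partners : ∀ {v w w′ e} → ¬ Image φ V⁻ v → Pair w w′ →
            e ≈ extend φ v ⟨ w ⟩ → ¬ e ≈ extend φ v ⟨ w′ ⟩
          distinct-partners v∉ P p q =
            pair-≢ P (same-edge (extend-injective φ⁻-inj v∉) (pair-∈E P) (pair-∈E (flip-pair P)) p q)

        chasing-no-copy : NoCopy (os ds)
        -- With one uncontrolled edge instead of two, `f` takes both places; `not-both` then says
        -- that `r` and `g` have different images.
        chasing-no-copy = no-copy-around-core φ⁻-inj f f legal
          (λ e∈ → [ inj₁ , inj₂ ∘ inj₂ ]′ (classify e∈)) distinct-partners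

        private
          answer-threat : ∀ {w w′ v} → Pair w w′ → Live w w′ v → Next ds
          answer-threat {w} {w′} {v} P (v∉ , f≈ , none) =
            c , c∉ds , c∉os , chasing record
              { own = own-∷ own ; φ-inj = φ-inj ; C = C ; a∈ = a∈ ; a≢z = a≢z ; χa∉ = χa∉
              ; classify = λ { (here refl) → inj₁ refl ; (there e∈) → inj₂ (reclassify (classify e∈)) } }
            where
            c-image = edge-image (extend-injective φ⁻-inj v∉) (pair-∈E (flip-pair P))
            c = proj₁ c-image
            c≈ = proj₂ c-image

            c∉ds : c ∉ᴸ ds
            c∉ds c∈ = none (lose c∈ c≈)

            v∈c : v ∈ᵉ c
            v∈c = apex∈ {φ} (z∈pair (flip-pair P)) c≈

            c∉os : c ∉ᴸ os ds
            c∉os c∈ with classify c∈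
            ... | inj₁ c≡f         = distinct-partners v∉ P (subst (_≈ extend φ v ⟨ w ⟩) (sym c≡f) f≈) c≈
            ... | inj₂ (inj₁ core) = v∉ (core⊆ φ⁻-inj core v∈c)
            -- If `c` were dead, its partner would be `f`, which the opponent owns.
            ... | inj₂ (inj₂ D)
              with refl ← apex-only {φ} (edge⊆V H (pair-∈E (Dead.pair D))) (Dead.e≈ D) v∈c v∉
              with same-pair (Dead.pair D) P
            ...   | inj₁ (refl , _) = distinct-partners v∉ P (Dead.e≈ D) c≈
            ...   | inj₂ (_ , refl) =
              legal (ω∈os ds) (subst (_∈ᴸ ds) (image-unique (Dead.partner≈ D) f≈) (Dead.partner∈ D))

            reclassify : ∀ {e} → e ≡ f ⊎ Core φ⁻-inj e ⊎ Dead φ⁻-inj ds e → Core φ⁻-inj e ⊎ Dead φ⁻-inj (c ∷ ds) e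
            reclassify (inj₁ refl) = inj₂ (record
              { apex∉ = v∉ ; pair = P ; e≈ = f≈ ; partner∈ = here refl ; partner≈ = c≈ })
            reclassify (inj₂ (inj₁ core)) = inj₁ core
            reclassify (inj₂ (inj₂ D)) = inj₂ (record
              { apex∉ = Dead.apex∉ D ; pair = Dead.pair D ; e≈ = Dead.e≈ D
              ; partner∈ = there (Dead.partner∈ D) ; partner≈ = Dead.partner≈ D })

          -- With nothing live, an edge that complements `f` at `v` is already in `ds`, so no `o`
          -- can be that edge. Copies of `F` stay in `φ(V⁻)`, so `a` makes the order `C` harmless.
          quiet : (∀ {w w′ v} → Pair w w′ → ¬ Live w w′ v) → Threatening ds
          quiet dead = record
            { C = C ; own = own ; X = os ds ; X⊆ = id ; classify = inj₁
            ; no-threat = λ o o∉ → no-copy-around-core φ⁻-inj f o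
                (λ { (here refl) → o∉ ; (there e∈) → legal e∈ })
                (λ { (here refl) → inj₂ (inj₁ refl)
                   ; (there e∈)  → [ inj₁ , inj₂ ∘ inj₂ ]′ (classify e∈) })
                (λ v∉ P f≈ o≈ → dead P (v∉ , f≈ , λ some → let c , c∈ , c≈ = find some in
                   o∉ (subst (_∈ᴸ ds) (image-unique c≈ o≈) c∈)))
            ; harmless = harmless-outside χ-inj C a∈ a≢z χa∉ (λ ψ-inj emb b∈ →
                let b′ , b′∈ , eq = F-image-inside φ⁻-inj f legal classify ψ-inj emb b∈
                in b′ , V⁻⊆V b′∈ , eq) }

        chase : Next ds
        -- A suitable `v` lies on `f`, so finitely many candidates have to be tested.
        chase with Anyⱽ.any? (λ v → live? r g v ⊎-dec live? g r v) (elements f)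
        ... | yes some with Anyⱽ.satisfied some
        ...   | _ , inj₁ live = answer-threat rg live
        ...   | _ , inj₂ live = answer-threat gr live
        chase | no none = threaten legal (quiet λ P live → none (loseⱽ
                  (apex∈ {φ} (z∈pair P) (proj₁ (proj₂ live))) (side P live)))
          where
          side : ∀ {w w′ v} → Pair w w′ → Live w w′ v → Live r g v ⊎ Live g r v
          side rg = inj₁
          side gr = inj₂

      -- If `e₀` avoids `z`, rigidity shows that the block ends all threats. If `e₀` is `r` or `g`,
      -- new threats can arise with `z` moved, and the chase begins.
      block-threat : ∀ {ds} → Legal-position ds → Blocking ds → Next ds
      block-threat {ds} legal B = block , block∉ds , block∉os , reply (z ∈? e₀)
        where
        open Blocking B
        ds⁺ = block ∷ ds

        legal⁺ : Legal-position ds⁺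
        legal⁺ = legal-move legal block∉os

        reply : Dec (z ∈ e₀) → State ds⁺
        reply (no z∉e₀) = threatening record
          { C = C ; own = own-∷ own ; X = os ds⁺ ; X⊆ = id ; classify = inj₁
          ; no-threat = λ o o∉ → no-copy-around-placed φ-inj (ω ds⁺) o e₀∈ z∉e₀ block≈
              (λ { (here refl) → o∉ (here refl) ; (there e∈) → legal⁺ e∈ (here refl) })
              (λ { (here refl)         → inj₂ (inj₁ refl)
                 ; (there (here refl)) → inj₁ refl
                 ; (there (there e∈))  → inj₂ (inj₂ (placed e∈)) })
          ; harmless = harmless-outside χ-inj C a∈ a≢z χa∉
              (F-image-inside′ φ-inj (ω ds⁺) λ { (here refl) → inj₁ refl ; (there e∈) → inj₂ (placed e∈) }) }
          where
          placed : ∀ {e} → e ∈ᴸ os ds → Placed φ-inj e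
          placed e∈ = let y , y∈ , _ , p = classify e∈ in y , y∈ , p
        reply (yes z∈e₀) = chasing record
          { own = own-∷ own ; φ-inj = φ-inj ; C = C ; a∈ = a∈ ; a≢z = a≢z ; χa∉ = χa∉
          ; classify = λ { (here refl) → inj₁ refl ; (there e∈) → inj₂ (core-or-dead (classify e∈)) } }
          where
          extend-self : ∀ {x} {e : Edge k} → e ≈ φ ⟨ x ⟩ → e ≈ extend φ (φ z) ⟨ x ⟩
          extend-self = image-cong λ {b} _ → case b ≟ᶠ z of λ
            { (yes refl) → sym (extend-z φ (φ z)) ; (no b≢z) → sym (extend-≢ b≢z) }

          -- Apart from the core there is only the other edge at `z`; it is dead with apex `φ z` and
          -- the block as its partner.
          core-or-dead : ∀ {e} → (∃ λ y → y ∈ᴸ E H × y ≢ e₀ × e ≈ φ ⟨ y ⟩) →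
            Core (V-inj φ-inj) e ⊎ Dead (V-inj φ-inj) ds⁺ e
          core-or-dead (y , y∈ , y≢e₀ , p) with z ∈? y
          ... | no z∉y = inj₁ (y , F⁺ y∈ z∉y , p)
          ... | yes z∈y with _ , P ← z-edge e₀∈ z∈e₀ with _ , Q ← z-edge y∈ z∈y with same-pair P Q
          ... | inj₁ (e₀≡y , _) = contradiction (sym e₀≡y) y≢e₀
          ... | inj₂ (refl , refl) = inj₂ (record
            { apex∉ = λ (b , b∈ , eq) → -∈⇒≢ b∈ (φ-inj (V⁻⊆V b∈) z∈V eq)
            ; pair = Q ; e≈ = extend-self p ; partner∈ = here refl ; partner≈ = extend-self block≈ })

      step : ∀ {ds} → Legal-position ds → State ds → Next ds
      step legal (threatening T) = threaten legal T
      step legal (chasing S)     = chase legal S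
      step legal (blocking B)    = block-threat legal B
      step legal (finishing R)   = let open Finishing R in last , last∉ds , last∉os , won copy
      step {ds} legal (won C)    =
        let e , e∉ = unclaimed (ds ++ os ds)
        in e , e∉ ∘ ∈-++⁺ˡ , e∉ ∘ ∈-++⁺ʳ ds ,
           won (embeds-copy (Copy.injective C) λ x∈ → let d , d∈ , p = copy-embeds C x∈ in d , there d∈ , p)

      safe : ∀ {ds} → Legal-position ds → State ds → Copy H (_∈ᴸ os ds) → Copy H (_∈ᴸ ds)
      safe legal (threatening T) copy = contradiction copy (threatening-no-copy legal T)
      safe legal (chasing S)     copy = contradiction copy (chasing-no-copy legal S)
      safe legal (blocking B)    copy = contradiction copy (Blocking.no-copy B)
      safe legal (finishing R)   copy = contradiction copy (Finishing.no-copy R)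
      safe legal (won C)         _    = C

      -- Entering the endgame

      record Threat (ds : List (Edge k)) : Set where
        field
          {φ}     : Fin n → ℕ
          φ-inj   : InjectiveOn (V H) φ
          {e₀}    : Subset n
          e₀∈     : e₀ ∈ᴸ E H
          others  : ∀ {x} → x ∈ᴸ E H → x ≢ e₀ → ∃ λ e → e ∈ᴸ os ds × e ≈ φ ⟨ x ⟩
          open-e₀ : ∀ {d} → d ∈ᴸ ds → ¬ d ≈ φ ⟨ e₀ ⟩

      module _ {ds} (legal : Legal-position ds) (own : Embeds F χ ds) (short : length ds ≤ length (E F))
               (apart : ∀ {a} → a ∈ V⁻ → ¬ χ a ∈ᵉ ω []) where

        no-copy-now : NoCopy (os ds)
        no-copy-now copy = no-copy-yet ds short (Copy.injective copy) (copy-embeds copy)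

        module _ (T : Threat ds) where
          open Threat T

          private
            block-image = edge-image φ-inj e₀∈
            block = proj₁ block-image

            block∉os : block ∉ᴸ os ds
            block∉os b∈ = no-copy-yet ds short φ-inj λ {x} x∈ → case x ≟ e₀ of λ
              { (yes refl) → block , b∈ , proj₂ block-image ; (no x≢e₀) → others x∈ x≢e₀ }

            embeds-with-block : Embeds H φ (block ∷ os ds)
            embeds-with-block {x} x∈ = case x ≟ e₀ of λ
              { (yes refl) → block , here refl , proj₂ block-image
              ; (no x≢e₀)  → let e , e∈ , p = others x∈ x≢e₀ in e , there e∈ , p }

            -- Even with the block added, the opponent's edges are no more than `H` has, so the copy
            -- that they form uses all of them.
            all-placed : ∀ {e} → e ∈ᴸ os ds → ∃ λ y → y ∈ᴸ E H × y ≢ e₀ × e ≈ φ ⟨ y ⟩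
            all-placed {e} e∈ =
              let y , y∈ , p = embedding-onto H φ-inj embeds-with-block fits (there e∈)
              in y , y∈ , differs p , p
              where
              differs : ∀ {y} → e ≈ φ ⟨ y ⟩ → y ≢ e₀
              differs p refl = block∉os (subst (_∈ᴸ os ds) (image-unique p (proj₂ block-image)) e∈)

              fits : length (block ∷ os ds) ≤ length (E H)
              fits = ≤-trans (s≤s (subst (_≤ suc (length (E F))) (sym (length-os ds)) (s≤s short))) size-F

            Free : Subset n → Set
            Free w = ∃ λ a → a ∈ w × a ≢ z × ¬ Image φ (V H) (χ a)

            free? : ∀ w → Dec (Free w)
            free? w = any? λ a → (a ∈? w) ×-dec (¬? (a ≟ᶠ z) ×-dec ¬? (image? φ (V H) (χ a)))

            -- An edge with a free vertex is taken as `c₂`, so that every answer leaves `φ(V H)`.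
            free-pair : ∃ λ c₁ → ∃ λ c₂ → Pair c₁ c₂ × Free c₂
            free-pair with free? r | free? g
            ... | yes free | _        = g , r , gr , free
            ... | no _     | yes free = r , g , rg , free
            ... | no none  | no none′ = ⊥-elim (too-many-vertices (ω []) χ-inj
                (λ v∈ → let y , y∈ , _ , p = all-placed (ω[]∈os ds) ; a , a∈ , eq = preimage p v∈
                        in a , edge⊆V H y∈ a∈ , eq)
                inside-φ apart)
              where
              inside-φ : ∀ {w w′ a} → Pair w w′ → a ∈ w → a ≢ z → Image φ (V H) (χ a)
              inside-φ {a = a} rg a∈ a≢z = decidable-stable (image? φ (V H) (χ a)) λ out → none (a , a∈ , a≢z , out)
              inside-φ {a = a} gr a∈ a≢z = decidable-stable (image? φ (V H) (χ a)) λ out → none′ (a , a∈ , a≢z , out)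

          face-threat : Blocking ds
          face-threat = let _ , _ , C , _ , a∈ , a≢z , χa∉ = free-pair in record
            { own = own ; no-copy = no-copy-now ; φ-inj = φ-inj
            ; C = C ; a∈ = a∈ ; a≢z = a≢z ; χa∉ = χa∉ ; e₀∈ = e₀∈
            ; block≈ = proj₂ block-image ; block∉ds = λ b∈ → open-e₀ b∈ (proj₂ block-image)
            ; block∉os = block∉os ; classify = all-placed }

        no-threat⇒threatening : ¬ Threat ds → ¬ ¬ Threatening ds
        no-threat⇒threatening calm = λ k → some-order-harmless χ-inj (os⁻ ds)
            (subst (_≤ length (E F)) (sym (length-replies ds)) short) apart
            [ k ∘ start rg , k ∘ start gr ]′
          where
          start : ∀ {c₁ c₂} (C : Pair c₁ c₂) → Harmless χ-inj C (os ds) → Threatening ds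
          start C harmless = record
            { C = C ; own = own ; X = os ds ; X⊆ = id ; classify = inj₁ ; harmless = harmless
            ; no-threat = λ o o∉ copy → decide o∉ copy (all⊎exists (split copy)) }
            where
            split : ∀ {o} (copy : Copy H (_∈ᴸ o ∷ os ds)) → ∀ {x} → x ∈ᴸ E H →
              o ≈ Copy.φ copy ⟨ x ⟩ ⊎ (∃ λ e → e ∈ᴸ os ds × e ≈ Copy.φ copy ⟨ x ⟩)
            split copy x∈ with copy-embeds copy x∈
            ... | _ , here refl , p = inj₁ p
            ... | e , there e∈  , p = inj₂ (e , e∈ , p)

            decide : ∀ {o} → o ∉ᴸ ds → (copy : Copy H (_∈ᴸ o ∷ os ds)) →
              ¬ ((∀ {x} → x ∈ᴸ E H → ∃ λ e → e ∈ᴸ os ds × e ≈ Copy.φ copy ⟨ x ⟩) ⊎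
                 (∃ λ x → x ∈ᴸ E H × o ≈ Copy.φ copy ⟨ x ⟩))
            decide o∉ copy (inj₁ all) = no-copy-yet ds short (Copy.injective copy) all
            decide o∉ copy (inj₂ (x , x∈ , o≈)) = calm (record
              { φ-inj = Copy.injective copy ; e₀∈ = x∈
              ; others = λ y∈ y≢x → [ (λ o≈y → contradiction (same-edge (Copy.injective copy) y∈ x∈ o≈y o≈) y≢x) , id ]′
                                      (split copy y∈)
              ; open-e₀ = λ d∈ d≈ → o∉ (subst (_∈ᴸ ds) (image-unique d≈ o≈) d∈) })

        endgame : ¬ ¬ State ds
        endgame k = no-threat⇒threatening (k ∘ blocking ∘ face-threat) (k ∘ threatening)

    -- The board of the fast strategy is shifted past the opponent's first edge.

    private
      c = above (ω [] ∷ [])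

    shift-increasing : ∀ {m} {xs : Vec ℕ m} → Linkedⱽ _<_ xs → Linkedⱽ _<_ (Vec.map (c +_) xs)
    shift-increasing []ˡ       = []ˡ
    shift-increasing [-]ˡ      = [-]ˡ
    shift-increasing {xs = _ ∷ _ ∷ _} (p ∷ˡ ps) = ℕₚ.+-monoʳ-< c p ∷ˡ shift-increasing ps

    shift : Edge k → Edge k
    shift e = edge (Vec.map (c +_) (elements e)) (shift-increasing (increasing e))

    ∈-shift⁺ : ∀ {v} (e : Edge k) → v ∈ᵉ e → c + v ∈ᵉ shift e
    ∈-shift⁺ e = ∈-mapⱽ⁺ (c +_)

    ∈-shift⁻ : ∀ {v} (e : Edge k) → v ∈ᵉ shift e → ∃ λ u → u ∈ᵉ e × c + u ≡ v
    ∈-shift⁻ e v∈ = let u , u∈ , eq = findⱽ (Anyⱽₚ.map⁻ v∈) in u , u∈ , sym eq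

    shift-injective : ∀ {e e′} → shift e ≡ shift e′ → e ≡ e′
    shift-injective {e} {e′} eq = edge-ext (transfer e e′ eq) (transfer e′ e (sym eq))
      where
      transfer : ∀ e e′ → shift e ≡ shift e′ → ∀ {v} → v ∈ᵉ e → v ∈ᵉ e′
      transfer e e′ eq v∈ with u , u∈ , p ← ∈-shift⁻ e′ (subst (_ ∈ᵉ_) eq (∈-shift⁺ e v∈)) =
        subst (_∈ᵉ e′) (ℕₚ.+-cancelˡ-≡ c _ _ p) u∈

    unshift : ∀ {m} {xs : Vec ℕ m} → Allⱽ (c ≤_) xs → Linkedⱽ _<_ xs →
      ∃ λ ys → Linkedⱽ _<_ ys × Vec.map (c +_) ys ≡ xs
    unshift {xs = xs} c≤ inc = Vec.map (_∸ c) xs , lowered c≤ inc , back c≤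
      where
      lowered : ∀ {m} {xs : Vec ℕ m} → Allⱽ (c ≤_) xs → Linkedⱽ _<_ xs → Linkedⱽ _<_ (Vec.map (_∸ c) xs)
      lowered _           []ˡ       = []ˡ
      lowered _           [-]ˡ      = [-]ˡ
      lowered {xs = _ ∷ _ ∷ _} (p ∷ᵃ ps) (q ∷ˡ qs) = ℕₚ.∸-monoˡ-< q p ∷ˡ lowered ps qs

      back : ∀ {m} {xs : Vec ℕ m} → Allⱽ (c ≤_) xs → Vec.map (c +_) (Vec.map (_∸ c) xs) ≡ xs
      back []ᵃ       = refl
      back (p ∷ᵃ ps) = cong₂ _∷_ (ℕₚ.m+[n∸m]≡n p) (back ps)

    shifted? : (o : Edge k) → Dec (∃ λ e → shift e ≡ o)
    shifted? o with Allⱽ.all? (c ≤?_) (elements o)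
    ... | yes c≤ = let ys , inc , eq = unshift c≤ (increasing o) in yes (edge ys inc , edge≡ eq)
    ... | no ¬c≤ = no λ { (e , refl) → ¬c≤ (tabulateⱽ _ λ v∈ →
            let u , _ , eq = ∈-shift⁻ e v∈ in subst (c ≤_) eq (ℕₚ.m≤m+n c u)) }

    edge-nonempty : (e : Edge k) → ∃ λ v → v ∈ᵉ e
    edge-nonempty e = first 2≤k (elements e)
      where
      first : ∀ {m} → 2 ≤ m → (xs : Vec ℕ m) → ∃ λ v → v ∈ⱽ xs
      first (s≤s _) (x ∷ _) = x , hereⱽ refl

    shift≢first : ∀ e → shift e ≢ ω []
    shift≢first e eq = let v , v∈ = edge-nonempty e in
      ℕₚ.<⇒≱ (∈⇒<above {ω [] ∷ []} (here refl) (subst (c + v ∈ᵉ_) eq (∈-shift⁺ e v∈))) (ℕₚ.m≤m+n c v)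

    open DecMembership (_≟ᵉ_ {k}) using () renaming (_∈?_ to _∈ᴸ?_)

    -- The fast strategy must see a legal reply to each of its moves. If the opponent's edge is off
    -- the shifted board or already claimed in the simulation, any unclaimed edge stands in for it;
    -- all that matters is that edges he takes on the shifted board are taken in the simulation too.
    translate : (h : List (Edge k)) (o : Edge k) →
      ∃ λ e → e ∉ᴸ h × (∀ e′ → shift e′ ≡ o → e′ ∈ᴸ h ⊎ e′ ≡ e)
    translate h o with shifted? o
    ... | no ¬shifted = let e , e∉ = unclaimed h in e , e∉ , λ e′ eq → contradiction (e′ , eq) ¬shifted
    ... | yes (e , refl) with e ∈ᴸ? h
    ...   | no e∉  = e , e∉ , λ e′ eq → inj₂ (shift-injective eq)
    ...   | yes e∈ = let d , d∉ = unclaimed h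
                     in d , d∉ , λ e′ eq → inj₁ (subst (_∈ᴸ h) (sym (shift-injective eq)) e∈)

    -- The opening: simulating the fast strategy

    module Opening (P : Player) (σ : Strategy k)
      (fast : ∀ p → Legal p → Follows P σ p → Copy F (Claimed p P (turn P (length (E F))))) where

      x₀ : Edge k
      x₀ = proj₁ (unclaimed [])

      -- `board i` is the history shown to `σ` before its move `i`, `moves i` the shifted moves made
      -- in the game, latest first.
      board : ℕ → List (Edge k)
      moves : ℕ → List (Edge k)
      guess : ∀ i → ∃ λ e → e ∉ᴸ board i ++ move σ (board i) ∷ [] ×
        (∀ e′ → shift e′ ≡ ω (shift (move σ (board i)) ∷ moves i) →
          e′ ∈ᴸ board i ++ move σ (board i) ∷ [] ⊎ e′ ≡ e)

      board zero    = opening x₀ P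
      board (suc i) = board i ++ move σ (board i) ∷ proj₁ (guess i) ∷ []
      moves zero    = []
      moves (suc i) = shift (move σ (board i)) ∷ moves i
      guess i = translate (board i ++ move σ (board i) ∷ []) (ω (shift (move σ (board i)) ∷ moves i))

      grows : ∀ i {e} → e ∈ᴸ board i ++ move σ (board i) ∷ [] ⊎ e ≡ proj₁ (guess i) → e ∈ᴸ board (suc i)
      grows i (inj₁ e∈) with ∈-++⁻ (board i) e∈
      ... | inj₁ old         = ∈-++⁺ˡ old
      ... | inj₂ (here refl) = ∈-++⁺ʳ (board i) (here refl)
      grows i (inj₂ refl) = ∈-++⁺ʳ (board i) (there (here refl))

      own-simulated : ∀ i {e} → shift e ∈ᴸ moves i → e ∈ᴸ board i
      own-simulated (suc i) (here eq)  = grows i (inj₁ (∈-++⁺ʳ (board i) (here (shift-injective eq))))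
      own-simulated (suc i) (there e∈) = grows i (inj₁ (∈-++⁺ˡ (own-simulated i e∈)))

      opponent-simulated : ∀ i {e} → shift e ∈ᴸ os (moves i) → e ∈ᴸ board i
      -- The opponent's first edge lies below the shifted board and is never shown to `σ`.
      opponent-simulated zero    (here eq)  = contradiction eq (shift≢first _)
      opponent-simulated (suc i) (here eq)  = grows i (proj₂ (proj₂ (guess i)) _ eq)
      opponent-simulated (suc i) (there e∈) = grows i (inj₁ (∈-++⁺ˡ (opponent-simulated i e∈)))

      next∉moves : ∀ i → shift (move σ (board i)) ∉ᴸ moves i
      next∉moves i e∈ = Strategy.legal σ (board i) (own-simulated i e∈)

      next∉os : ∀ i → shift (move σ (board i)) ∉ᴸ os (moves i)
      next∉os i e∈ = Strategy.legal σ (board i) (opponent-simulated i e∈)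

      length-moves : ∀ i → length (moves i) ≡ i
      length-moves zero    = refl
      length-moves (suc i) = cong suc (length-moves i)

      moves-legal : ∀ i → Legal-position (moves i)
      moves-legal zero    _ ()
      moves-legal (suc i) = legal-move (moves-legal i) (next∉os i)

      ∈-moves : ∀ {i j} → i < j → shift (move σ (board i)) ∈ᴸ moves j
      ∈-moves {i} {suc j} (s≤s i≤j) with ℕₚ.m≤n⇒m<n∨m≡n i≤j
      ... | inj₁ i<j  = there (∈-moves i<j)
      ... | inj₂ refl = here refl

      M = length (E F)

      simulated : PlayedOut P σ x₀ board (proj₁ ∘ guess)
      simulated = play-out P σ x₀ board (proj₁ ∘ guess) refl (λ _ → refl) (proj₁ ∘ proj₂ ∘ guess)

      copy-of-F : Copy F (Claimed (PlayedOut.play simulated) P (turn P M))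
      copy-of-F = fast _ (PlayedOut.allowed simulated) (PlayedOut.follows simulated)

      χ : Fin n → ℕ
      χ a = c + Copy.φ copy-of-F a

      χ-inj : InjectiveOn V⁻ χ
      χ-inj a∈ b∈ eq = Copy.injective copy-of-F a∈ b∈ (ℕₚ.+-cancelˡ-≡ c _ _ eq)

      χ-apart : ∀ {a} → a ∈ V⁻ → ¬ χ a ∈ᵉ ω []
      χ-apart _ v∈ = ℕₚ.<⇒≱ (∈⇒<above {ω [] ∷ []} (here refl) v∈) (ℕₚ.m≤m+n c _)

      turn-cancel-< : ∀ {i j} → turn P i < turn P j → i < j
      turn-cancel-< = cancel P
        where
        cancel : ∀ Q {i j} → turn Q i < turn Q j → i < j
        cancel FP i<j       = ℕₚ.*-cancelˡ-< 2 _ _ i<j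
        cancel SP (s≤s i<j) = ℕₚ.*-cancelˡ-< 2 _ _ i<j

      χ-embeds : Embeds F χ (moves M)
      χ-embeds x∈ with e , (i , i<M , eq) , p ← Copy.maps-E copy-of-F x∈ =
        shift e ,
        subst (λ d → shift d ∈ᴸ moves M) (trans (sym (PlayedOut.own simulated i)) eq) (∈-moves (turn-cancel-< i<M)) ,
        isImage (λ v∈ → let u , u∈ , cu≡v = ∈-shift⁻ e v∈ ; a , a∈ , q = preimage (fromImage e p) u∈
                        in a , a∈ , trans (cong (c +_) q) cu≡v)
                (λ a∈ → ∈-shift⁺ e (covers (fromImage e p) a∈))

      open Endgame χ-inj

      endgame-reached : ¬ ¬ State (moves M)
      endgame-reached = endgame (moves-legal M) χ-embeds (ℕₚ.≤-reflexive (length-moves M)) χ-apart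

      -- Joining the opening and the endgame into one sequence of moves

      Position : List (Edge k) → Set
      Position ds = Legal-position ds × ((∃ λ j → j < M × ds ≡ moves j) ⊎ State ds)

      module _ (state₀ : State (moves M)) where

        at-move : ∀ j → j ≤ M → Position (moves j)
        at-move j j≤M with ℕₚ.m≤n⇒m<n∨m≡n j≤M
        ... | inj₁ j<M  = moves-legal j , inj₁ (j , j<M , refl)
        ... | inj₂ refl = moves-legal j , inj₂ state₀

        advance : ∀ {ds} → Position ds → ∃ λ d → d ∉ᴸ ds × d ∉ᴸ os ds × Position (d ∷ ds)
        advance (_ , inj₁ (j , j<M , refl)) =
          shift (move σ (board j)) , next∉moves j , next∉os j , at-move (suc j) j<M
        advance (legal , inj₂ S) =
          let d , d∉ds , d∉os , S′ = step legal S in d , d∉ds , d∉os , legal-move legal d∉os , inj₂ S′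

        position-safe : ∀ {ds} → Position ds → Copy H (_∈ᴸ os ds) → Copy H (_∈ᴸ ds)
        position-safe (_ , inj₁ (j , j<M , refl)) copy = ⊥-elim
          (no-copy-yet (moves j) (subst (_≤ M) (sym (length-moves j)) (<⇒≤ j<M))
            (Copy.injective copy) (copy-embeds copy))
        position-safe (legal , inj₂ S) = safe legal S

        run : ℕ → Σ (List (Edge k)) Position
        run zero    = [] , at-move 0 z≤n
        run (suc i) = let ds , p = run i ; d , _ , _ , p′ = advance p in d ∷ ds , p′

        d : ℕ → Edge k
        d i = proj₁ (advance (proj₂ (run i)))

    prefix : (ℕ → Edge k) → ℕ → List (Edge k)
    prefix d zero    = []
    prefix d (suc i) = d i ∷ prefix d i

    -- A sequence against the fixed `ω` rather than a strategy. The opponent may complete copies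
    -- once the drawing player has one, as he is then not the first.
    Drawing : (ℕ → Edge k) → Set
    Drawing d = ∀ i → d i ∉ᴸ prefix d i × d i ∉ᴸ os (prefix d i) ×
      (Copy H (_∈ᴸ os (prefix d i)) → Copy H (_∈ᴸ prefix d i))

    drawing-exists : FastWinningStrategy F → ¬ ¬ ∃ Drawing
    drawing-exists (P , σ , fast) none = endgame-reached λ S → none (d S , drawing S)
      where
      open Opening P σ fast

      prefix≡ : ∀ S i → prefix (d S) i ≡ proj₁ (run S i)
      prefix≡ S zero    = refl
      prefix≡ S (suc i) = cong (d S i ∷_) (prefix≡ S i)

      drawing : ∀ S → Drawing (d S)
      drawing S i rewrite prefix≡ S i =
        let p = proj₂ (run S i) ; _ , d∉ds , d∉os , _ = advance S p in d∉ds , d∉os , position-safe S p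

  -- Refuting a strategy that is supposed to win

  copy-mono : {C C′ : Pred (Edge k) 0ℓ} → (∀ {e} → C e → C′ e) → Copy H C → Copy H C′
  copy-mono f copy = record
    { φ = Copy.φ copy ; injective = Copy.injective copy
    ; maps-E = λ x∈ → let e , Ce , p = Copy.maps-E copy x∈ in e , f Ce , p }

  spoken : Player → List (Edge k) → Edge k → List (Edge k)
  spoken SP [] _ = []
  spoken _  _  e = e ∷ []

  ∈-spoken : ∀ P ds {e e′} → e ∈ᴸ spoken P ds e′ → e ≡ e′
  ∈-spoken FP []      (here eq) = eq
  ∈-spoken FP (_ ∷ _) (here eq) = eq
  ∈-spoken SP (_ ∷ _) (here eq) = eq

  -- The number of moves the drawing player has made before move i of the opponent P.
  moves-before : Player → ℕ → ℕ
  moves-before FP i = i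
  moves-before SP i = suc i

  moves-before≤ : ∀ P {i j} → turn P j < suc (2 * i) → moves-before P j ≤ i
  moves-before≤ FP (s≤s 2j≤2i)      = ℕₚ.*-cancelˡ-≤ 2 2j≤2i
  moves-before≤ SP (s≤s 2j<2i)      = ℕₚ.*-cancelˡ-< 2 _ _ 2j<2i

  turn-opponent< : ∀ P {i j} → j < i → turn (opponent P) j < 2 * i
  turn-opponent< FP {i} {j} j<i = subst (_≤ 2 * i) (2*suc j) (ℕₚ.*-monoʳ-≤ 2 j<i)
  turn-opponent< SP j<i         = ℕₚ.*-monoʳ-< 2 j<i

  -- If P moves second, then P's first edge in the game against d is a dummy that is not played.
  module Refutation (P : Player) (σ : Strategy k) where

    past : List (Edge k) → List (Edge k)
    past []       = []
    past (d ∷ ds) = past ds ++ spoken P ds (move σ (past ds)) ++ d ∷ []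

    ω : List (Edge k) → Edge k
    ω ds = move σ (past ds)

    ⊆past : ∀ ds {e} → e ∈ᴸ ds → e ∈ᴸ past ds
    ⊆past (d ∷ ds) (here refl) = ∈-++⁺ʳ (past ds) (∈-++⁺ʳ (spoken P ds (ω ds)) (here refl))
    ⊆past (d ∷ ds) (there e∈)  = ∈-++⁺ˡ (⊆past ds e∈)

    -- No claim is made about the opponent's own edges: the dummy of a second player is missing from
    -- the history, so `σ` may choose it again.
    ω-legal : ∀ ds → ω ds ∉ᴸ ds
    ω-legal ds e∈ = Strategy.legal σ (past ds) (⊆past ds e∈)

    open Game ω ω-legal

    past⊆ : ∀ ds {e} → e ∈ᴸ past ds → e ∈ᴸ ds ⊎ e ∈ᴸ os ds
    past⊆ (d ∷ ds) e∈ with ∈-++⁻ (past ds) e∈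
    ... | inj₁ older = [ inj₁ ∘ there , inj₂ ∘ there ]′ (past⊆ ds older)
    ... | inj₂ newer with ∈-++⁻ (spoken P ds (ω ds)) newer
    ...   | inj₂ (here refl) = inj₁ (here refl)
    ...   | inj₁ reply       = inj₂ (there (subst (_∈ᴸ os ds) (sym (∈-spoken P ds reply)) (ω∈os ds)))

    module _ {d : ℕ → Edge k} (drawing : Drawing d) where

      ds : ℕ → List (Edge k)
      ds = prefix d

      ω∈os-later : ∀ {i j} → i ≤ j → ω (ds i) ∈ᴸ os (ds j)
      ω∈os-later {i} {j} i≤j with ℕₚ.m≤n⇒m<n∨m≡n i≤j
      ... | inj₂ refl      = ω∈os (ds i)
      ω∈os-later {j = suc j} _ | inj₁ (s≤s i≤j) = there (ω∈os-later i≤j)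

      ∈ds⁻ : ∀ i {e} → e ∈ᴸ ds i → ∃ λ j → j < i × d j ≡ e
      ∈ds⁻ (suc i) (here refl) = i , ≤-refl , refl
      ∈ds⁻ (suc i) (there e∈)  = let j , j<i , eq = ∈ds⁻ i e∈ in j , ℕₚ.m<n⇒m<1+n j<i , eq

      h : ℕ → List (Edge k)
      h i = past (ds (moves-before P i))

      a : ℕ → Edge k
      a i = d (moves-before P i)

      h-zero : ∀ Q → Q ≡ P → h 0 ≡ opening (d 0) P
      h-zero FP refl = refl
      h-zero SP refl = refl

      h-suc : ∀ Q → Q ≡ P → ∀ i → h (suc i) ≡ h i ++ move σ (h i) ∷ a i ∷ []
      h-suc FP refl zero    = refl
      h-suc FP refl (suc i) = refl
      h-suc SP refl i       = refl

      a-legal : ∀ i → a i ∉ᴸ h i ++ move σ (h i) ∷ []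
      a-legal i a∈ with d∉ds , d∉os , _ ← drawing (moves-before P i) | ∈-++⁻ (h i) a∈
      ... | inj₁ a∈h         = [ d∉ds , d∉os ]′ (past⊆ (ds (moves-before P i)) a∈h)
      ... | inj₂ (here eq)   = d∉os (subst (_∈ᴸ os (ds (moves-before P i))) (sym eq) (ω∈os (ds (moves-before P i))))

      open PlayedOut (play-out P σ (d 0) h a (h-zero P refl) (h-suc P refl) a-legal)

      drawing-moves : ∀ Q → Q ≡ P → ∀ j → play (turn (opponent P) j) ≡ d j
      drawing-moves FP refl j       = other j
      drawing-moves SP refl zero    = first refl
      drawing-moves SP refl (suc j) = trans (cong play (2*suc j)) (other j)

      opponent-edges : ∀ {i t e} → t ≤ suc (2 * i) → Claimed play P t e → e ∈ᴸ os (ds i)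
      opponent-edges t≤ (j , turn<t , eq) = subst (_∈ᴸ os _) (trans (sym (own j)) eq)
        (ω∈os-later (moves-before≤ P (≤-trans turn<t t≤)))

      drawing-edges : ∀ {i t e} → 2 * i ≤ t → e ∈ᴸ ds i → Claimed play (opponent P) t e
      drawing-edges ≤t e∈ = let j , j<i , eq = ∈ds⁻ _ e∈ in
        j , ≤-trans (turn-opponent< P j<i) ≤t , trans (drawing-moves P refl j) eq

      -- At times `2 * i` and `2 * i + 1` the opponent owns at most `os (ds i)` and the drawing
      -- player at least `ds i`, whoever moves first.
      not-won : ¬ Wins H P play
      not-won (t , copy , no-copy) with half t
      ... | i , t-half = no-copy (copy-mono (drawing-edges (2i≤t t-half))
              (proj₂ (proj₂ (drawing i)) (copy-mono (opponent-edges (t≤1+2i t-half)) copy)))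
        where
        2i≤t : t ≡ 2 * i ⊎ t ≡ suc (2 * i) → 2 * i ≤ t
        2i≤t (inj₁ refl) = ≤-refl
        2i≤t (inj₂ refl) = ℕₚ.n≤1+n _

        t≤1+2i : t ≡ 2 * i ⊎ t ≡ suc (2 * i) → t ≤ suc (2 * i)
        t≤1+2i (inj₁ refl) = ℕₚ.n≤1+n _
        t≤1+2i (inj₂ refl) = ≤-refl

      not-winning : ¬ WinningStrategy H P σ
      not-winning wins = not-won (wins play allowed follows)

  draw : FastWinningStrategy F → Draw H
  draw fast P (σ , wins) =
    Game.drawing-exists ω ω-legal fast λ (_ , drawing) → not-winning drawing wins
    where open Refutation P σ

theorem3p1 : ∀ {k n : ℕ} → 2 ≤ k → (H : Hypergraph k n) →
  (z : Fin n) → z ∈ V H → degree H z ≡ 2 →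
  (r g : Subset n) → r ∈ᴸ E H → g ∈ᴸ E H → r ≢ g → z ∈ r → z ∈ g →
  3 ≤ δ (H ∖ᵛ z) →
  (∀ u → u ∈ V H → u ≢ z → 4 ≤ degree H u) →
  FastWinningStrategy (H ∖ᵛ z) →
  (∀ e e′ → e ∈ᴸ E H → e′ ∈ᴸ E H → e ≢ e′ →
    ∀ φ → Monomorphism (H ∖ᴱ (e ∷ e′ ∷ [])) H φ →
    ∀ a → a ∈ V (H ∖ᴱ (e ∷ e′ ∷ [])) → φ a ≡ a) →
  (∀ e → e ∈ᴸ E H → Nonempty (e ∩ r) × Nonempty (e ∩ g)) →
  ∣ V H ─ (r ∪ g) ∣ < k ∸ 1 →
  Draw H
theorem3p1 2≤k H z z∈V deg-z r g r∈E g∈E r≢g z∈r z∈g δ≥3 deg≥4 fast rigid meets few =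
  Setting.draw 2≤k H z z∈V deg-z r g r∈E g∈E r≢g z∈r z∈g δ≥3 deg≥4 rigid meets few fast
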